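{- Let $G$ be a 2-connected chordless graph that is not 2-sparse. Let $(X,Y,a,b)$ be a split of a proper 2-cutset of $G$ such that $|X|$ is minimum among all splits of proper 2-cutsets of $G$. Then $a$ and $b$ each have at least two neighbours in $X$, and the block $G_X$ is 2-sparse.
   Context: Graphs are finite and simple. A graph is chordless if no cycle has a chord (an edge joining two vertices of the cycle that is not an edge of the cycle). A graph is 2-sparse if every edge is incident to at least one vertex of degree at most 2. A proper 2-cutset of a connected graph $G=(V,E)$ is a pair of non-adjacent vertices $a,b$ such that $V$ can be partitioned into non-empty sets $X$, $Y$ and $\{a,b\}$ so that there is no edge between $X$ and $Y$, both $G[X\cup\{a,b\}]$ and $G[Y\cup\{a,b\}]$ contain an $ab$-path, and neither $G[X\cup\{a,b\}]$ nor $G[Y\cup\{a,b\}]$ is a chordless path (induced path); $(X,Y,a,b)$ is then called a split of this proper 2-cutset. The block $G_X$ is the graph obtained from $G[X\cup\{a,b\}]$ by adding a new vertex $w$ adjacent exactly to $a$ and $b$. -}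

module Defs where

open import Data.Nat using (ℕ; zero; suc; _+_; _≤_; _≥_)
open import Data.Fin using (Fin; zero; suc; toℕ; _≟_)
open import Data.Bool using (Bool; true; false; not; _∨_; _∧_; if_then_else_)
open import Data.Bool.Properties using (∨-comm)
open import Data.Product using (Σ; ∃; ∃-syntax; _×_; _,_)
open import Data.Sum using (_⊎_)
open import Data.Empty using (⊥)
open import Function using (_∘_)
open import Function.Bundles using (_⇔_)
open import Relation.Nullary using (¬_)
open import Relation.Nullary.Decidable using (⌊_⌋)
open import Relation.Binary.PropositionalEquality using (_≡_; _≢_; refl)

record Graph : Set where
  field
    n      : ℕ
    E      : Fin n → Fin n → Bool
    sym    : ∀ u v → E u v ≡ E v u
    irrefl : ∀ v → E v v ≡ false
open Graph public

Adj : (G : Graph) → Fin (n G) → Fin (n G) → Set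
Adj G u v = E G u v ≡ true

VSet : ℕ → Set
VSet m = Fin m → Bool

_∈ₛ_ : ∀ {m} → Fin m → VSet m → Set
v ∈ₛ S = S v ≡ true

full : ∀ {m} → VSet m
full _ = true

count : ∀ {m} → VSet m → ℕ
count {zero}  _ = 0
count {suc m} p = (if p zero then 1 else 0) + count (p ∘ suc)

degIn : (G : Graph) → VSet (n G) → Fin (n G) → ℕ
degIn G S v = count (λ u → S u ∧ E G v u)

TwoSparseOn : (G : Graph) → VSet (n G) → Set
TwoSparseOn G S = ∀ u v → u ∈ₛ S → v ∈ₛ S → Adj G u v →
  (degIn G S u ≤ 2) ⊎ (degIn G S v ≤ 2)

TwoSparse : Graph → Set
TwoSparse G = TwoSparseOn G full

record PathIn (G : Graph) (S : VSet (n G)) (a b : Fin (n G)) : Set where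
  field
    len   : ℕ
    f     : Fin (suc len) → Fin (n G)
    inj   : ∀ i j → f i ≡ f j → i ≡ j
    inS   : ∀ i → f i ∈ₛ S
    start : ∃[ i ] (toℕ i ≡ 0 × f i ≡ a)
    end   : ∃[ i ] (toℕ i ≡ len × f i ≡ b)
    step  : ∀ i j → suc (toℕ i) ≡ toℕ j → Adj G (f i) (f j)

ConnectedOn : (G : Graph) → VSet (n G) → Set
ConnectedOn G S = ∀ u v → u ∈ₛ S → v ∈ₛ S → PathIn G S u v

Connected : Graph → Set
Connected G = ConnectedOn G full

TwoConnected : Graph → Set
TwoConnected G = (n G ≥ 3) × Connected G ×
  (∀ v → ConnectedOn G (λ u → not ⌊ u ≟ v ⌋))

record IsChordlessPath (G : Graph) (S : VSet (n G)) : Set where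
  field
    len    : ℕ
    f      : Fin (suc len) → Fin (n G)
    inj    : ∀ i j → f i ≡ f j → i ≡ j
    onto   : ∀ v → v ∈ₛ S ⇔ (∃[ i ] f i ≡ v)
    adjIff : ∀ i j → Adj G (f i) (f j) ⇔
               ((suc (toℕ i) ≡ toℕ j) ⊎ (suc (toℕ j) ≡ toℕ i))

CycNext : (k : ℕ) → Fin k → Fin k → Set
CycNext k i j = (suc (toℕ i) ≡ toℕ j) ⊎ ((suc (toℕ i) ≡ k) × (toℕ j ≡ 0))

record Cycle (G : Graph) : Set where
  field
    len  : ℕ
    len≥3 : len ≥ 3
    f    : Fin len → Fin (n G)
    inj  : ∀ i j → f i ≡ f j → i ≡ j
    step : ∀ i j → CycNext len i j → Adj G (f i) (f j)

HasChord : (G : Graph) → Cycle G → Set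
HasChord G C = ∃[ i ] ∃[ j ] (Adj G (f i) (f j) × ¬ CycNext len i j × ¬ CycNext len j i)
  where open Cycle C

Chordless : Graph → Set
Chordless G = ∀ (C : Cycle G) → ¬ HasChord G C

_∪ab : ∀ {m} → VSet m → Fin m × Fin m → VSet m
(X ∪ab) (a , b) v = X v ∨ ⌊ v ≟ a ⌋ ∨ ⌊ v ≟ b ⌋

record Split (G : Graph) (X Y : VSet (n G)) (a b : Fin (n G)) : Set where
  field
    a≢b      : a ≢ b
    nonadj   : ¬ Adj G a b
    cover    : ∀ v → v ∈ₛ X ⊎ v ∈ₛ Y ⊎ v ≡ a ⊎ v ≡ b
    XY-disj  : ∀ v → v ∈ₛ X → ¬ v ∈ₛ Y
    a∉X      : ¬ a ∈ₛ X
    b∉X      : ¬ b ∈ₛ X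
    a∉Y      : ¬ a ∈ₛ Y
    b∉Y      : ¬ b ∈ₛ Y
    X≠∅      : ∃[ x ] x ∈ₛ X
    Y≠∅      : ∃[ y ] y ∈ₛ Y
    noEdge   : ∀ x y → x ∈ₛ X → y ∈ₛ Y → ¬ Adj G x y
    pathX    : PathIn G ((X ∪ab) (a , b)) a b
    pathY    : PathIn G ((Y ∪ab) (a , b)) a b
    notPathX : ¬ IsChordlessPath G ((X ∪ab) (a , b))
    notPathY : ¬ IsChordlessPath G ((Y ∪ab) (a , b))

-- The block G_X.  It is represented as the induced subgraph, on the vertex
-- set (X ∪ {a,b}) ∪ {w}, of the graph on Fin (suc n) whose vertex `zero`
-- is the new vertex w (adjacent exactly to a and b) and whose vertex
-- `suc v` is the old vertex v (old adjacencies kept).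

wAdj : ∀ {m} → Fin m → Fin m → Fin m → Bool
wAdj a b v = ⌊ v ≟ a ⌋ ∨ ⌊ v ≟ b ⌋

extE : (G : Graph) → Fin (n G) → Fin (n G) → Fin (suc (n G)) → Fin (suc (n G)) → Bool
extE G a b zero    zero    = false
extE G a b zero    (suc v) = wAdj a b v
extE G a b (suc u) zero    = wAdj a b u
extE G a b (suc u) (suc v) = E G u v

extE-sym : ∀ G a b u v → extE G a b u v ≡ extE G a b v u
extE-sym G a b zero    zero    = refl
extE-sym G a b zero    (suc v) = refl
extE-sym G a b (suc u) zero    = refl
extE-sym G a b (suc u) (suc v) = sym G u v

extE-irrefl : ∀ G a b v → extE G a b v v ≡ false
extE-irrefl G a b zero    = refl
extE-irrefl G a b (suc v) = irrefl G v

extGraph : (G : Graph) → Fin (n G) → Fin (n G) → Graph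
extGraph G a b = record
  { n = suc (n G) ; E = extE G a b
  ; sym = extE-sym G a b ; irrefl = extE-irrefl G a b }

blockSet : (G : Graph) → VSet (n G) → Fin (n G) → Fin (n G) → VSet (suc (n G))
blockSet G X a b zero    = true
blockSet G X a b (suc v) = (X ∪ab) (a , b) v

BlockTwoSparse : (G : Graph) → VSet (n G) → Fin (n G) → Fin (n G) → Set
BlockTwoSparse G X a b = TwoSparseOn (extGraph G a b) (blockSet G X a b)

nbrsIn : (G : Graph) → VSet (n G) → Fin (n G) → ℕ
nbrsIn G X v = degIn G X v

{-# OPTIONS --safe #-}
module Submission where

-- If a had a single neighbour a′ in X, then (X ∖ a′, Y ∪ a, a′, b) would be a smaller split;
-- a′ b is not an edge, since it would be a chord of a cycle through X and Y.
--
-- Let uv be an edge of G[X ∪ {a,b}] whose ends both have degree at least 3.  If no vertex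
-- z ∉ {u,v} separated u from v in G − uv, Menger's theorem would give a cycle with chord uv.
-- So some z does, and it can be taken outside Y: a separator in Y can be replaced by whichever
-- of a, b is not an end of uv.  Let P ∋ u and Q ∋ v be the two sides.  All of (Y ∪ {a,b}) ∖ z
-- lies on one side, say Q, so P is a proper subset of X.  The vertices u, v, z do not form a
-- triangle (uz would be a chord), so {u,z} or {v,z} is a proper 2-cutset, with P ∖ u or P as
-- one side of a split, contradicting the minimality of X.

open import Defs
open import Data.Nat using (ℕ; zero; suc; _+_; _≤_; _<_; _≥_; z≤n; s≤s)
open import Data.Nat.Properties as ℕₚ using (≤-trans; ≤-refl; ≤-reflexive; ≰⇒>; <⇒≱; suc-injective)
open import Data.Fin using (Fin; zero; suc; toℕ; fromℕ; fromℕ<; inject₁; opposite; _≟_)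
open import Data.Fin.Properties using (toℕ-injective; toℕ-fromℕ; toℕ-fromℕ<; toℕ-inject₁; toℕ<n; opposite-prop; opposite-involutive; any?) renaming (suc-injective to Fin-suc-injective)
open import Data.Bool using (Bool; true; false; not; _∨_; _∧_; if_then_else_)
import Data.Bool.Properties as Bool
open import Data.Product using (Σ; ∃-syntax; ∃₂; _×_; _,_; proj₁; proj₂)
open import Data.Sum using (_⊎_; inj₁; inj₂; [_,_]′; swap) renaming (map to ⊎-map)
open import Data.Empty using (⊥; ⊥-elim)
open import Function using (_∘_; id; case_of_)
open import Function.Bundles using (_⇔_; mk⇔; module Equivalence)
open import Relation.Nullary using (¬_; Dec; yes; no; contradiction)
open import Relation.Nullary.Decidable using (⌊_⌋; _×-dec_; _⊎-dec_; ¬?; decidable-stable)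
open import Relation.Binary.PropositionalEquality using (_≡_; _≢_; refl; cong; cong₂; trans; subst; subst₂) renaming (sym to ≡-sym)
open import Relation.Binary.Construct.Closure.ReflexiveTransitive using (Star; ε; _◅_; _◅◅_; kleisliStar; reverse) renaming (map to Star-map)

open Equivalence using (to; from)

-- The first conclusion feeds the second. An end of `uv` that is `a` or `b` has two neighbours in
-- `X` and one in `Y`, hence degree at least 3 in `G` itself; and its neighbours in `X` show that
-- `P` misses part of `X` even when `v` is not in `X`.
--
-- The separator `z` is moved out of `Y` because `Y ∪ {a,b}` minus `z` is then connected. A
-- separator inside `Y` could leave pieces of `Y` on both sides, so that neither side need lie in
-- `X`.
--
-- Degree at least 3 makes the new cutset proper. Inside `P ∪ z` the vertex `u` loses only the
-- neighbour `v`, so every vertex there except perhaps `z` keeps two neighbours, which an end of a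
-- chordless path does not have; and `v` keeps three neighbours in `Q ∪ {u,z}`.

private
  variable
    A : Set
    m : ℕ

-- Vertex sets and counting

infixl 6 _∖_ _∪₁_

_∖_ : VSet m → Fin m → VSet m
(X ∖ u) w = X w ∧ not ⌊ w ≟ u ⌋

_∪₁_ : VSet m → Fin m → VSet m
(X ∪₁ u) w = X w ∨ ⌊ w ≟ u ⌋

_∈?_ : (w : Fin m) (X : VSet m) → Dec (w ∈ₛ X)
w ∈? X = X w Bool.≟ true

≢⁺ : {w u : Fin m} → w ≢ u → not ⌊ w ≟ u ⌋ ≡ true
≢⁺ {w = w} {u} w≢u with w ≟ u
... | yes w≡u = contradiction w≡u w≢u
... | no _    = refl

≢⁻ : {w u : Fin m} → not ⌊ w ≟ u ⌋ ≡ true → w ≢ u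
≢⁻ {w = w} {u} t with w ≟ u
≢⁻ () | yes _
... | no w≢u = w≢u

∖⁺ : (X : VSet m) {u w : Fin m} → w ∈ₛ X → w ≢ u → w ∈ₛ (X ∖ u)
∖⁺ X w∈X w≢u rewrite w∈X = ≢⁺ w≢u

∖⁻ : (X : VSet m) {u w : Fin m} → w ∈ₛ (X ∖ u) → w ∈ₛ X × w ≢ u
∖⁻ X {u} {w} t with X w
∖⁻ X t | true = refl , ≢⁻ t
∖⁻ X () | false

∧⁺ : ∀ {s t} → s ≡ true → t ≡ true → s ∧ t ≡ true
∧⁺ refl refl = refl

∧⁻ : ∀ {s t} → s ∧ t ≡ true → s ≡ true × t ≡ true
∧⁻ {true} {true} refl = refl , refl

≟-true : (w : Fin m) → ⌊ w ≟ w ⌋ ≡ true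
≟-true w with w ≟ w
... | yes _  = refl
... | no w≢w = contradiction refl w≢w

∪₁⁺ : (X : VSet m) {u w : Fin m} → w ∈ₛ X ⊎ w ≡ u → w ∈ₛ (X ∪₁ u)
∪₁⁺ X (inj₁ w∈X) rewrite w∈X = refl
∪₁⁺ X {u} (inj₂ refl) rewrite ≟-true u = Bool.∨-zeroʳ (X u)

∪₁⁻ : (X : VSet m) {u w : Fin m} → w ∈ₛ (X ∪₁ u) → w ∈ₛ X ⊎ w ≡ u
∪₁⁻ X {u} {w} t with X w | w ≟ u
... | true  | _       = inj₁ refl
... | false | yes w≡u = inj₂ w≡u
∪₁⁻ X () | false | no _

InX∪ : VSet m → Fin m → Fin m → Fin m → Set
InX∪ X a b w = w ∈ₛ X ⊎ w ≡ a ⊎ w ≡ b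

∪ab⁺ : (X : VSet m) (a b : Fin m) {w : Fin m} → InX∪ X a b w → w ∈ₛ (X ∪ab) (a , b)
∪ab⁺ X a b (inj₁ w∈X) rewrite w∈X = refl
∪ab⁺ X a b (inj₂ (inj₁ refl)) rewrite ≟-true a = Bool.∨-zeroʳ (X a)
∪ab⁺ X a b (inj₂ (inj₂ refl))
  rewrite ≟-true b | Bool.∨-zeroʳ ⌊ b ≟ a ⌋ = Bool.∨-zeroʳ (X b)

∪ab⁻ : (X : VSet m) (a b : Fin m) {w : Fin m} → w ∈ₛ (X ∪ab) (a , b) → InX∪ X a b w
∪ab⁻ X a b {w} t with X w | w ≟ a | w ≟ b
... | true  | _       | _       = inj₁ refl
... | false | yes w≡a | _       = inj₂ (inj₁ w≡a)
... | false | no _    | yes w≡b = inj₂ (inj₂ w≡b)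
∪ab⁻ X a b () | false | no _ | no _

∪ab-comm : (X : VSet m) (a b : Fin m) {w : Fin m} → w ∈ₛ (X ∪ab) (a , b) → w ∈ₛ (X ∪ab) (b , a)
∪ab-comm X a b w∈ = ∪ab⁺ X b a (⊎-map id swap (∪ab⁻ X a b w∈))

count-mono : (p q : VSet m) → (∀ w → w ∈ₛ p → w ∈ₛ q) → count p ≤ count q
count-mono {zero} p q p⊆q = z≤n
count-mono {suc m} p q p⊆q with p zero | q zero | p⊆q zero
... | false | _     | _ = ≤-trans (count-mono (p ∘ suc) (q ∘ suc) (p⊆q ∘ suc)) (ℕₚ.m≤n+m _ _)
... | true  | true  | _ = s≤s (count-mono (p ∘ suc) (q ∘ suc) (p⊆q ∘ suc))
... | true  | false | h with () ← h refl

count-remove : (p : VSet m) (x : Fin m) → x ∈ₛ p → count p ≡ suc (count (p ∖ x))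
count-remove {suc m} p zero x∈p rewrite x∈p = cong suc (ℕₚ.≤-antisym
  (count-mono (p ∘ suc) ((p ∖ zero) ∘ suc) λ w w∈p → ∖⁺ p {zero} w∈p λ ())
  (count-mono ((p ∖ zero) ∘ suc) (p ∘ suc) λ w w∈ → proj₁ (∖⁻ p {zero} {suc w} w∈)))
count-remove {suc m} p (suc x) x∈p =
  trans (cong ((if p zero then 1 else 0) +_) (count-remove (p ∘ suc) x x∈p))
    (trans (ℕₚ.+-suc (if p zero then 1 else 0) _) (cong suc (cong₂ _+_ head tail)))
  where
  head : (if p zero then 1 else 0) ≡ (if (p ∖ suc x) zero then 1 else 0)
  head = cong (λ t → if t then 1 else 0) (≡-sym (Bool.∧-identityʳ (p zero)))

  tail : count ((p ∘ suc) ∖ x) ≡ count ((p ∖ suc x) ∘ suc)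
  tail = ℕₚ.≤-antisym
    (count-mono ((p ∘ suc) ∖ x) ((p ∖ suc x) ∘ suc) λ w w∈ →
      let w∈p , w≢x = ∖⁻ (p ∘ suc) {x} {w} w∈ in ∖⁺ p w∈p (w≢x ∘ Fin-suc-injective))
    (count-mono ((p ∖ suc x) ∘ suc) ((p ∘ suc) ∖ x) λ w w∈ →
      let w∈p , w≢x = ∖⁻ p {suc x} {suc w} w∈ in ∖⁺ (p ∘ suc) w∈p (w≢x ∘ cong suc))

count-strict : (p q : VSet m) {x : Fin m} → (∀ w → w ∈ₛ p → w ∈ₛ q) →
  x ∈ₛ q → ¬ x ∈ₛ p → count p < count q
count-strict p q {x} p⊆q x∈q x∉p rewrite count-remove q x x∈q =
  s≤s (count-mono p (q ∖ x) λ w w∈p → ∖⁺ q (p⊆q w w∈p) λ { refl → x∉p w∈p })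

count-witness : (p : VSet m) {k : ℕ} → suc k ≤ count p → ∃[ x ] x ∈ₛ p × k ≤ count (p ∖ x)
count-witness {m} p k<c with any? (_∈? p)
... | yes (x , x∈p) = x , x∈p , ℕₚ.≤-pred (≤-trans k<c (≤-reflexive (count-remove p x x∈p)))
... | no none = contradiction (≤-trans k<c (count-empty p λ w w∈p → none (w , w∈p))) λ ()
  where
  count-empty : ∀ {m} (p : VSet m) → (∀ w → ¬ w ∈ₛ p) → count p ≤ 0
  count-empty {zero} p ∅ = z≤n
  count-empty {suc m} p ∅ with p zero in eq
  ... | true  = contradiction eq (∅ zero)
  ... | false = count-empty (p ∘ suc) (∅ ∘ suc)

-- Lower bounds on degrees are turned into distinct witnesses early: witnesses pass along any
-- implication between predicates and can be chosen to avoid given vertices.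
Two Three : (A → Set) → Set
Two T   = ∃₂ λ x y → (T x × T y) × x ≢ y
Three T = ∃₂ λ x y → ∃[ z ] (T x × T y × T z) × x ≢ y × x ≢ z × y ≢ z

Two-map : {T U : A → Set} → (∀ {x} → T x → U x) → Two T → Two U
Two-map f (x , y , (tx , ty) , x≢y) = x , y , (f tx , f ty) , x≢y

Three-map : {T U : A → Set} → (∀ {x} → T x → U x) → Three T → Three U
Three-map f (x , y , z , (tx , ty , tz) , distinct) = x , y , z , (f tx , f ty , f tz) , distinct

count≥2⇒Two : {p : VSet m} → 2 ≤ count p → Two (_∈ₛ p)
count≥2⇒Two {p = p} c
  with x , x∈p , c₁ ← count-witness p c
  with y , y∈p₁ , _ ← count-witness (p ∖ x) c₁
  with y∈p , y≢x ← ∖⁻ p y∈p₁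
  = x , y , (x∈p , y∈p) , y≢x ∘ ≡-sym

count≥3⇒Three : {p : VSet m} → 3 ≤ count p → Three (_∈ₛ p)
count≥3⇒Three {p = p} c
  with x , x∈p , c₁ ← count-witness p c
  with y , z , (y∈p₁ , z∈p₁) , y≢z ← count≥2⇒Two c₁
  with y∈p , y≢x ← ∖⁻ p y∈p₁ | z∈p , z≢x ← ∖⁻ p z∈p₁
  = x , y , z , (x∈p , y∈p , z∈p) , y≢x ∘ ≡-sym , z≢x ∘ ≡-sym , y≢z

count<2⇒unique : {p : VSet m} → ¬ 2 ≤ count p → ∀ x y → x ∈ₛ p → y ∈ₛ p → x ≡ y
count<2⇒unique {p = p} c x y x∈p y∈p with x ≟ y
... | yes x≡y = x≡y
... | no x≢y = contradiction (≤-trans (s≤s (≤-trans (s≤s z≤n)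
    (≤-reflexive (≡-sym (count-remove (p ∖ x) y (∖⁺ p y∈p (x≢y ∘ ≡-sym)))))))
  (≤-reflexive (≡-sym (count-remove p x x∈p)))) c

Two-avoid : {T : Fin m → Set} → Two T → ∀ v → ∃[ w ] T w × w ≢ v
Two-avoid (x , y , (tx , ty) , x≢y) v with x ≟ v
... | no x≢v   = x , tx , x≢v
... | yes refl = y , ty , x≢y ∘ ≡-sym

Three-avoid : {T : Fin m → Set} → Three T → ∀ v → Two (λ w → T w × w ≢ v)
Three-avoid (x , y , z , (tx , ty , tz) , x≢y , x≢z , y≢z) v with x ≟ v
... | yes refl = y , z , ((ty , x≢y ∘ ≡-sym) , (tz , x≢z ∘ ≡-sym)) , y≢z
... | no x≢v with Two-avoid (y , z , (ty , tz) , y≢z) v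
... | w , tw , w≢v with w ≟ x
... | no w≢x = x , w , ((tx , x≢v) , (tw , w≢v)) , w≢x ∘ ≡-sym
... | yes refl with y ≟ v
... | no y≢v   = x , y , ((tx , x≢v) , (ty , y≢v)) , x≢y
... | yes refl = x , z , ((tx , x≢v) , (tz , y≢z ∘ ≡-sym)) , x≢z

-- Walks and simple paths

-- Both ends of every edge are kept in `S`, so the restriction of a symmetric relation is symmetric
-- and its walks reverse. The empty walk says nothing about `S`, hence the separate hypothesis `S x`
-- in `loopErase`.
_↾_ : (A → A → Set) → (A → Set) → A → A → Set
(R ↾ S) x y = R x y × S x × S y

↾-mono : {R : A → A → Set} {S T : A → Set} → (∀ {w} → S w → T w) →
  ∀ {x y} → Star (R ↾ S) x y → Star (R ↾ T) x y
↾-mono S⊆T = Star-map λ (e , sx , sy) → e , S⊆T sx , S⊆T sy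

-- Confines a walk supplied by 2-connectivity to one side of a cut: the only way out of `T` is `z`,
-- and the walk is stopped there.
until : {R : A → A → Set} {S T : A → Set} {x z : A} →
  (∀ {s t} → T s → R s t → S s → S t → T t ⊎ t ≡ z) →
  T x → Star (R ↾ S) x z → Star (R ↾ (λ w → T w ⊎ w ≡ z)) x z
until cl tx ε = ε
until cl tx ((e , sx , sy) ◅ s) with cl tx e sx sy
... | inj₁ ty   = (e , inj₁ tx , inj₁ ty) ◅ until cl ty s
... | inj₂ refl = (e , inj₁ tx , inj₂ refl) ◅ ε

boundary : {R : A → A → Set} {T : A → Set} {x z : A} → (∀ w → Dec (T w)) →
  T x → ¬ T z → Star R x z → ∃₂ λ s t → T s × ¬ T t × R s t
boundary T? tx ¬tz ε = contradiction tx ¬tz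
boundary T? tx ¬tz (_◅_ {j = y} e s) with T? y
... | yes ty = boundary T? ty ¬tz s
... | no ¬ty = _ , y , tx , ¬ty , e

invariant : {R : A → A → Set} {T : A → Set} → (∀ {s t} → R s t → T s → T t) →
  ∀ {x y} → Star R x y → T x → T y
invariant cl ε tx = tx
invariant cl (e ◅ s) tx = invariant cl s (cl e tx)

infix 4 _∈ᵖ_

-- Paths that are simple by construction, so that cutting and joining them is structural recursion.
-- The indexed vertex sequences of `PathIn` and `Cycle` are obtained from them by `at`.
mutual
  data SPath (R : Fin m → Fin m → Set) : Fin m → Fin m → Set where
    [_]  : ∀ x → SPath R x x
    cons : ∀ {x y z} → R x y → (p : SPath R y z) → ¬ x ∈ᵖ p → SPath R x z

  _∈ᵖ_ : {R : Fin m → Fin m → Set} {x y : Fin m} → Fin m → SPath R x y → Set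
  w ∈ᵖ [ x ]            = w ≡ x
  w ∈ᵖ cons {x} _ p _   = w ≡ x ⊎ w ∈ᵖ p

module _ {R : Fin m → Fin m → Set} where

  infix 4 _∈ᵖ?_

  _∈ᵖ?_ : ∀ {x y} w (p : SPath R x y) → Dec (w ∈ᵖ p)
  w ∈ᵖ? [ x ]            = w ≟ x
  w ∈ᵖ? cons {x} _ p _   = (w ≟ x) ⊎-dec (w ∈ᵖ? p)

  first∈ : ∀ {x y} (p : SPath R x y) → x ∈ᵖ p
  first∈ [ x ]        = refl
  first∈ (cons _ _ _) = inj₁ refl

  last∈ : ∀ {x y} (p : SPath R x y) → y ∈ᵖ p
  last∈ [ x ]        = refl
  last∈ (cons _ p _) = inj₂ (last∈ p)

  suffix : ∀ {x z t} (p : SPath R x z) → t ∈ᵖ p →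
    Σ (SPath R t z) λ q → (∀ {w} → w ∈ᵖ q → w ∈ᵖ p) × (t ≢ x → ¬ x ∈ᵖ q)
  suffix [ x ] refl = [ x ] , id , contradiction refl
  suffix p@(cons _ _ _) (inj₁ refl) = p , id , contradiction refl
  suffix (cons _ p x∉p) (inj₂ t∈p) with q , q⊆p , _ ← suffix p t∈p =
    q , inj₂ ∘ q⊆p , λ _ → x∉p ∘ q⊆p

  firstHit : {T : Fin m → Set} (T? : ∀ w → Dec (T w)) → ∀ {x z} (p : SPath R x z) → T z →
    ∃[ t ] T t × Σ (SPath R x t) λ q → (∀ {w} → w ∈ᵖ q → w ∈ᵖ p) × (∀ {w} → w ∈ᵖ q → T w → w ≡ t)
  firstHit T? [ x ] tz = x , tz , [ x ] , id , λ w≡x _ → w≡x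
  firstHit T? (cons {x} e p x∉p) tz with T? x
  ... | yes tx = x , tx , [ x ] , inj₁ , λ w≡x _ → w≡x
  ... | no ¬tx with t , tt , q , q⊆p , hit ← firstHit T? p tz =
    t , tt , cons e q (x∉p ∘ q⊆p) , ⊎-map id q⊆p ,
    λ { (inj₁ refl) tw → contradiction tw ¬tx ; (inj₂ w∈q) tw → hit w∈q tw }

  append : ∀ {x y z} (p : SPath R x y) (q : SPath R y z) → (∀ {w} → w ∈ᵖ p → w ∈ᵖ q → w ≡ y) →
    Σ (SPath R x z) λ r → (∀ {w} → w ∈ᵖ r → w ∈ᵖ p ⊎ w ∈ᵖ q) × (∀ {w} → w ∈ᵖ p → w ∈ᵖ r)
  append [ x ] q _ = q , inj₂ , λ { refl → first∈ q }
  append (cons {x} e p x∉p) q meet with r , r⊆ , p⊆r ← append p q (meet ∘ inj₂) =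
    cons e r (λ x∈r → [ x∉p , (λ x∈q → x∉p (subst (_∈ᵖ p) (≡-sym (meet (inj₁ refl) x∈q)) (last∈ p))) ]′ (r⊆ x∈r)) ,
    [ inj₁ ∘ inj₁ , ⊎-map inj₂ id ∘ r⊆ ]′ , ⊎-map id p⊆r

  -- Reversal with an accumulator: the edges of `p` move one at a time, reversed, to the front of
  -- `q`. Plain reversal is the case of a one-vertex `q`.
  reverse-append : (∀ {s t} → R s t → R t s) → ∀ {x y z} (p : SPath R x y) (q : SPath R x z) →
    (∀ {w} → w ∈ᵖ p → w ∈ᵖ q → w ≡ x) →
    Σ (SPath R y z) λ r → ∀ {w} → w ∈ᵖ r → w ∈ᵖ p ⊎ w ∈ᵖ q
  reverse-append R-sym [ x ] q _ = q , inj₂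
  reverse-append R-sym (cons {x} {y} e p x∉p) q meet
    with r , r⊆ ← reverse-append R-sym p
           (cons (R-sym e) q λ y∈q → x∉p (subst (_∈ᵖ p) (meet (inj₂ (first∈ p)) y∈q) (first∈ p)))
           (λ { w∈p (inj₁ w≡y) → w≡y
              ; w∈p (inj₂ w∈q) → contradiction (subst (_∈ᵖ p) (meet (inj₂ w∈p) w∈q) w∈p) x∉p })
    = r , λ w∈r → [ inj₁ ∘ inj₂ , [ (λ { refl → inj₁ (inj₂ (first∈ p)) }) , inj₂ ]′ ]′ (r⊆ w∈r)

  loopErase : {S : Fin m → Set} → ∀ {x y} → S x → Star (R ↾ S) x y →
    Σ (SPath R x y) λ p → ∀ {w} → w ∈ᵖ p → S w
  loopErase sx ε = [ _ ] , λ { refl → sx }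
  loopErase {x = x} sx ((e , _ , sy) ◅ s) with p , p⊆S ← loopErase sy s | x ∈ᵖ? p
  ... | no x∉p = cons e p x∉p , [ (λ { refl → sx }) , p⊆S ]′
  ... | yes x∈p with q , q⊆p , _ ← suffix p x∈p = q , p⊆S ∘ q⊆p

  size : ∀ {x y} → SPath R x y → ℕ
  size [ _ ]        = 0
  size (cons _ p _) = suc (size p)

  at : ∀ {x y} (p : SPath R x y) → Fin (suc (size p)) → Fin m
  at [ x ]            _       = x
  at (cons {x} _ _ _) zero    = x
  at (cons _ p _)     (suc i) = at p i

  at-∈ : ∀ {x y} (p : SPath R x y) i → at p i ∈ᵖ p
  at-∈ [ x ]        _       = refl
  at-∈ (cons _ _ _) zero    = inj₁ refl
  at-∈ (cons _ p _) (suc i) = inj₂ (at-∈ p i)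

  ∈-at : ∀ {x y w} (p : SPath R x y) → w ∈ᵖ p → ∃[ i ] at p i ≡ w
  ∈-at [ x ]        refl        = zero , refl
  ∈-at (cons _ _ _) (inj₁ refl) = zero , refl
  ∈-at (cons _ p _) (inj₂ w∈p) with i , eq ← ∈-at p w∈p = suc i , eq

  at-injective : ∀ {x y} (p : SPath R x y) i j → at p i ≡ at p j → i ≡ j
  at-injective [ x ] zero zero _ = refl
  at-injective (cons _ _ _) zero zero _ = refl
  at-injective (cons _ p x∉p) zero (suc j) eq = contradiction (subst (_∈ᵖ p) (≡-sym eq) (at-∈ p j)) x∉p
  at-injective (cons _ p x∉p) (suc i) zero eq = contradiction (subst (_∈ᵖ p) eq (at-∈ p i)) x∉p
  at-injective (cons _ p _) (suc i) (suc j) eq = cong suc (at-injective p i j eq)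

  at-first : ∀ {x y} (p : SPath R x y) → at p zero ≡ x
  at-first [ x ]        = refl
  at-first (cons _ _ _) = refl

  at-last : ∀ {x y} (p : SPath R x y) i → toℕ i ≡ size p → at p i ≡ y
  at-last [ x ]        _       _  = refl
  at-last (cons _ p _) (suc i) eq = at-last p i (suc-injective eq)

  at-step : ∀ {x y} (p : SPath R x y) i j → suc (toℕ i) ≡ toℕ j → R (at p i) (at p j)
  at-step [ x ] zero zero ()
  at-step (cons e p _) zero (suc zero) _ = subst (R _) (≡-sym (at-first p)) e
  at-step (cons _ p _) (suc i) (suc j) eq = at-step p i j (suc-injective eq)

SPath-map : {R R′ : Fin m → Fin m → Set} → (∀ {s t} → R s t → R′ s t) →
  ∀ {x y} (p : SPath R x y) → Σ (SPath R′ x y) λ p′ → ∀ {w} → w ∈ᵖ p′ → w ∈ᵖ p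
SPath-map f [ x ] = [ x ] , id
SPath-map f (cons e p x∉p) = let p′ , p′⊆p = SPath-map f p in cons (f e) p′ (x∉p ∘ p′⊆p) , ⊎-map id p′⊆p

-- A two-path form of Menger's theorem

-- The two paths may be one and the same edge. This degenerate case starts the induction in
-- `twoPaths`; it cannot occur in the application, where the edge between the two ends has been
-- deleted.
TwoPaths : (R : Fin m → Fin m → Set) → Fin m → Fin m → Set
TwoPaths R x u = ∃₂ λ (p q : SPath R x u) → ∀ {w} → w ∈ᵖ p → w ∈ᵖ q → w ≡ x ⊎ w ≡ u

module _ {R : Fin m → Fin m → Set} {u : Fin m} where

  -- The path r from y to u enters p ∪ q first at t, say on p; follow p from there,
  -- and reach q from y through x.
  twoPaths-step : ∀ {x y} → y ≢ u → y ≢ x → R y x →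
    (r : SPath R y u) → ¬ x ∈ᵖ r → TwoPaths R x u → TwoPaths R y u
  twoPaths-step {x} {y} y≢u y≢x e r x∉r (p , q , meet)
    with t , t∈ , r₁ , r₁⊆r , hit ← firstHit (λ w → (w ∈ᵖ? p) ⊎-dec (w ∈ᵖ? q)) r (inj₁ (last∈ p))
    = [ via p q meet hit , via q p (λ w∈q w∈p → meet w∈p w∈q) (λ w∈r₁ → hit w∈r₁ ∘ swap) ]′ t∈
    where
    t≢x : t ≢ x
    t≢x refl = x∉r (r₁⊆r (last∈ r₁))

    via : (p q : SPath R x u) → (∀ {w} → w ∈ᵖ p → w ∈ᵖ q → w ≡ x ⊎ w ≡ u) →
      (∀ {w} → w ∈ᵖ r₁ → w ∈ᵖ p ⊎ w ∈ᵖ q → w ≡ t) → t ∈ᵖ p → TwoPaths R y u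
    via p q meet hit t∈p
      with p₂ , p₂⊆p , x∉p₂ ← suffix p t∈p
      with p′ , p′⊆ , _ ← append r₁ p₂ (λ w∈r₁ w∈p₂ → hit w∈r₁ (inj₁ (p₂⊆p w∈p₂)))
      = p′ , cons e q y∉q , λ
        { w∈p′ (inj₁ w≡y) → inj₁ w≡y
        ; w∈p′ (inj₂ w∈q) → inj₂ (common w∈q (p′⊆ w∈p′)) }
      where
      common₂ : ∀ {w} → w ∈ᵖ q → w ∈ᵖ p₂ → w ≡ u
      common₂ w∈q w∈p₂ with meet (p₂⊆p w∈p₂) w∈q
      ... | inj₁ refl = contradiction w∈p₂ (x∉p₂ t≢x)
      ... | inj₂ w≡u  = w≡u

      common : ∀ {w} → w ∈ᵖ q → w ∈ᵖ r₁ ⊎ w ∈ᵖ p₂ → w ≡ u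
      common w∈q (inj₂ w∈p₂) = common₂ w∈q w∈p₂
      common w∈q (inj₁ w∈r₁) with refl ← hit w∈r₁ (inj₂ w∈q) = common₂ w∈q (first∈ p₂)

      y∉q : ¬ y ∈ᵖ q
      y∉q y∈q = y≢u (common y∈q (inj₁ (first∈ r₁)))

  -- Induction along a given path to `u`, backwards from its last edge. The hypothesis says that no
  -- vertex other than `u` separates another vertex from `u`; it supplies the third path that
  -- `twoPaths-step` reroutes.
  twoPaths : (∀ {x y} → x ≢ u → y ≢ x → Σ (SPath R y u) λ r → ¬ x ∈ᵖ r) →
    ∀ {x} → SPath R x u → x ≢ u → TwoPaths R x u
  twoPaths bypass [ _ ] x≢u = contradiction refl x≢u
  twoPaths bypass (cons {x} {y} e p x∉p) x≢u with y ≟ u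
  ... | yes refl = cons e [ u ] x≢u , cons e [ u ] x≢u , λ w∈p _ → w∈p
  ... | no y≢u with x≢y ← (λ { refl → x∉p (first∈ p) })
    with r , y∉r ← bypass y≢u x≢y
    = twoPaths-step x≢u x≢y e r y∉r (twoPaths bypass p y≢u)

-- Reachable sets

reachable : {R : Fin m → Fin m → Set} → (∀ x y → Dec (R x y)) → (u : Fin m) →
  Σ (VSet m) λ P → u ∈ₛ P × (∀ {x} → x ∈ₛ P → Star R u x) × (∀ {x y} → x ∈ₛ P → R x y → y ∈ₛ P)
reachable {m} {R} R? u = grow m (λ w → ⌊ w ≟ u ⌋) (≟-true u) start (ℕₚ.m≤n+m _ _)
  where
  start : ∀ {x} → ⌊ x ≟ u ⌋ ≡ true → Star R u x
  start {x} t with x ≟ u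
  ... | yes refl = ε
  start () | no _

  count≤ : ∀ {k} (p : VSet k) → count p ≤ k
  count≤ {zero} p = z≤n
  count≤ {suc k} p with p zero
  ... | true  = s≤s (count≤ (p ∘ suc))
  ... | false = ℕₚ.m≤n⇒m≤1+n (count≤ (p ∘ suc))

  -- The fuel `k` bounds the number of vertices outside `P`, and each round moves one of them into
  -- `P`. With no fuel left, a further vertex would give more than `m` vertices.
  grow : ∀ k (P : VSet m) → u ∈ₛ P → (∀ {x} → x ∈ₛ P → Star R u x) → m ≤ count P + k →
    Σ (VSet m) λ P → u ∈ₛ P × (∀ {x} → x ∈ₛ P → Star R u x) × (∀ {x y} → x ∈ₛ P → R x y → y ∈ₛ P)
  grow k P u∈P walk m≤ with any? (λ x → any? λ y → (x ∈? P) ×-dec R? x y ×-dec ¬? (y ∈? P))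
  ... | no none = P , u∈P , walk , λ {x} {y} x∈P e →
    decidable-stable (y ∈? P) λ y∉P → none (x , y , x∈P , e , y∉P)
  grow zero P u∈P walk m≤ | yes (x , y , x∈P , e , y∉P) =
    contradiction (≤-trans (ℕₚ.≤-trans (s≤s (≤-trans m≤ (≤-reflexive (ℕₚ.+-identityʳ _))))
      (count-strict P full (λ _ _ → refl) refl y∉P)) (count≤ {m} full)) (ℕₚ.<-irrefl refl)
  grow (suc k) P u∈P walk m≤ | yes (x , y , x∈P , e , y∉P) =
    grow k (P ∪₁ y) (∪₁⁺ P (inj₁ u∈P))
      (λ w∈ → [ walk , (λ { refl → walk x∈P ◅◅ (e ◅ ε) }) ]′ (∪₁⁻ P w∈))
      (≤-trans m≤ (≤-trans (≤-reflexive (ℕₚ.+-suc _ k))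
        (ℕₚ.+-monoˡ-≤ k (count-strict P (P ∪₁ y) (λ w w∈P → ∪₁⁺ P (inj₁ w∈P)) (∪₁⁺ P (inj₂ refl)) y∉P))))

-- Chordless paths

opposite-next : ∀ {k} (i j : Fin (suc k)) → suc (toℕ i) ≡ toℕ j →
  suc (toℕ (opposite j)) ≡ toℕ (opposite i)
opposite-next {k} i j eq rewrite opposite-prop i | opposite-prop j | ≡-sym eq =
  ≡-sym (ℕₚ.+-∸-assoc 1 {k} {suc (toℕ i)} (subst (_≤ k) (≡-sym eq) (ℕₚ.≤-pred (toℕ<n j))))

opposite-next⁻ : ∀ {k} (i j : Fin (suc k)) → suc (toℕ (opposite i)) ≡ toℕ (opposite j) →
  suc (toℕ j) ≡ toℕ i
opposite-next⁻ i j eq = subst₂ (λ s t → suc (toℕ s) ≡ toℕ t) (opposite-involutive j) (opposite-involutive i)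
  (opposite-next (opposite i) (opposite j) eq)

module _ {G : Graph} where

  Adj-sym : ∀ {u v} → Adj G u v → Adj G v u
  Adj-sym {u} {v} e = trans (sym G v u) e

  Adj⇒≢ : ∀ {u v} → Adj G u v → u ≢ v
  Adj⇒≢ {u} e refl with () ← trans (≡-sym e) (irrefl G u)

  Adj? : ∀ u v → Dec (Adj G u v)
  Adj? u v = E G u v Bool.≟ true

  module _ {S : VSet (n G)} where

    first : IsChordlessPath G S → Fin (n G)
    first c = IsChordlessPath.f c zero

    PathFrom : Fin (n G) → Set
    PathFrom v = Σ (IsChordlessPath G S) λ c → first c ≡ v

    chordlessPath-reverse : IsChordlessPath G S → IsChordlessPath G S
    chordlessPath-reverse c = record
      { len    = len
      ; f      = f ∘ opposite
      ; inj    = λ i j eq → trans (≡-sym (opposite-involutive i))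
                   (trans (cong opposite (inj _ _ eq)) (opposite-involutive j))
      ; onto   = λ v → mk⇔
          (λ v∈S → let i , eq = to (onto v) v∈S in
            opposite i , trans (cong f (opposite-involutive i)) eq)
          (λ (i , eq) → from (onto v) (opposite i , eq))
      ; adjIff = λ i j → mk⇔
          ([ inj₂ ∘ opposite-next⁻ i j , inj₁ ∘ opposite-next⁻ j i ]′ ∘ to (adjIff _ _))
          (from (adjIff _ _) ∘ [ inj₂ ∘ opposite-next i j , inj₁ ∘ opposite-next j i ]′)
      }
      where open IsChordlessPath c

    first-∈ : (c : IsChordlessPath G S) → first c ∈ₛ S
    first-∈ c = from (IsChordlessPath.onto c _) (zero , refl)

    first-nbr-unique : (c : IsChordlessPath G S) → ∀ {x y} → x ∈ₛ S → y ∈ₛ S →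
      Adj G (first c) x → Adj G (first c) y → x ≡ y
    first-nbr-unique c {x} {y} x∈S y∈S ex ey
      with i , refl ← to (IsChordlessPath.onto c x) x∈S | j , refl ← to (IsChordlessPath.onto c y) y∈S
      with to (IsChordlessPath.adjIff c zero i) ex | to (IsChordlessPath.adjIff c zero j) ey
    ... | inj₁ p | inj₁ q = cong (IsChordlessPath.f c) (toℕ-injective (trans (≡-sym p) q))

    -- If both orientations started at `z`, the path would have `z` as its only vertex, contrary to
    -- `x`.
    start-≢ : IsChordlessPath G S → ∀ {x z} → x ∈ₛ S → x ≢ z →
      Σ (IsChordlessPath G S) λ c → first c ≢ z
    start-≢ c {x} {z} x∈S x≢z with first c ≟ z
    ... | no f₀≢z = c , f₀≢z
    ... | yes f₀≡z = chordlessPath-reverse c , λ fₗ≡z → x≢z (single (inj zero (opposite zero) (trans f₀≡z (≡-sym fₗ≡z))))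
      where
      open IsChordlessPath c
      single : zero ≡ opposite zero → x ≡ z
      single eq with i , refl ← to (onto x) x∈S = trans (cong f (toℕ-injective i≡0)) f₀≡z
        where
        len≡0 : len ≡ 0
        len≡0 = trans (≡-sym (opposite-prop {suc len} zero)) (cong toℕ (≡-sym eq))
        i≡0 : toℕ i ≡ 0
        i≡0 = ℕₚ.n≤0⇒n≡0 (subst (toℕ i ≤_) len≡0 (ℕₚ.≤-pred (toℕ<n i)))

    low-degree-end : IsChordlessPath G S → ∀ {x z} → x ∈ₛ S → x ≢ z →
      ¬ (∀ {v} → v ∈ₛ S → v ≢ z → Two (λ w → w ∈ₛ S × Adj G v w))
    low-degree-end c₀ x∈S x≢z two =
      let c , f₀≢z = start-≢ c₀ x∈S x≢z
          _ , _ , ((x∈ , ex) , (y∈ , ey)) , x≢y = two (first-∈ c) f₀≢z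
      in x≢y (first-nbr-unique c x∈ y∈ ex ey)

    -- The vertex at an inner position `k + 1` has the two distinct neighbours at `k` and `k + 2`,
    -- so a vertex with at most one neighbour is first or last.
    start-at : IsChordlessPath G S → ∀ {v} → v ∈ₛ S →
      (∀ {x y} → x ∈ₛ S → y ∈ₛ S → Adj G v x → Adj G v y → x ≡ y) →
      PathFrom v
    start-at c {v} v∈S unique with to (IsChordlessPath.onto c v) v∈S
    ... | zero , eq = c , eq
    ... | suc k , refl with suc (toℕ k) ℕₚ.<? IsChordlessPath.len c
    ... | no k≮ = chordlessPath-reverse c , cong (IsChordlessPath.f c) (toℕ-injective
        (trans (opposite-prop {suc (IsChordlessPath.len c)} zero) (ℕₚ.≤-antisym (ℕₚ.≮⇒≥ k≮) (toℕ<n k))))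
    ... | yes k< = contradiction
        (trans (trans (≡-sym toℕ-before) (cong toℕ before≡after)) (toℕ-fromℕ< (s≤s k<)))
        (ℕₚ.<⇒≢ (ℕₚ.m≤n⇒m≤1+n ≤-refl))
      where
      open IsChordlessPath c
      before after : Fin (suc len)
      before = inject₁ k
      after  = fromℕ< (s≤s k<)

      toℕ-before : toℕ before ≡ toℕ k
      toℕ-before = toℕ-inject₁ k

      before≡after : before ≡ after
      before≡after = inj _ _ (unique (from (onto _) (before , refl)) (from (onto _) (after , refl))
        (from (adjIff _ _) (inj₂ (cong suc toℕ-before)))
        (from (adjIff _ _) (inj₁ (≡-sym (toℕ-fromℕ< (s≤s k<))))))

    no-three-nbrs : IsChordlessPath G S → ∀ {v} → v ∈ₛ S → ¬ Three (λ x → x ∈ₛ S × Adj G v x)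
    no-three-nbrs c {v} v∈S (x , y , z , ((x∈S , ex) , (y∈S , ey) , (z∈S , ez)) , x≢y , x≢z , y≢z)
      with k , refl ← to (IsChordlessPath.onto c v) v∈S
      = pigeonhole (side x∈S ex) (side y∈S ey) (side z∈S ez)
      where
      open IsChordlessPath c
      After Before : Fin (n G) → Set
      After w  = ∃[ i ] f i ≡ w × suc (toℕ k) ≡ toℕ i
      Before w = ∃[ i ] f i ≡ w × suc (toℕ i) ≡ toℕ k

      side : ∀ {w} → w ∈ₛ S → Adj G (f k) w → After w ⊎ Before w
      side w∈S e with i , refl ← to (onto _) w∈S = ⊎-map (λ p → i , refl , p) (λ p → i , refl , p) (to (adjIff k i) e)

      after : ∀ {s t} → After s → After t → s ≡ t
      after (i , refl , p) (j , refl , q) = cong f (toℕ-injective (trans (≡-sym p) q))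

      before : ∀ {s t} → Before s → Before t → s ≡ t
      before (i , refl , p) (j , refl , q) = cong f (toℕ-injective (suc-injective (trans p (≡-sym q))))

      pigeonhole : After x ⊎ Before x → After y ⊎ Before y → After z ⊎ Before z → ⊥
      pigeonhole (inj₁ p) (inj₁ q) _        = x≢y (after p q)
      pigeonhole (inj₂ p) (inj₂ q) _        = x≢y (before p q)
      pigeonhole (inj₁ p) (inj₂ q) (inj₁ r) = x≢z (after p r)
      pigeonhole (inj₁ p) (inj₂ q) (inj₂ r) = y≢z (before q r)
      pigeonhole (inj₂ p) (inj₁ q) (inj₁ r) = y≢z (after q r)
      pigeonhole (inj₂ p) (inj₁ q) (inj₂ r) = x≢z (before p r)

  chordlessPath-resp : ∀ {S S′} → (∀ {w} → w ∈ₛ S → w ∈ₛ S′) → (∀ {w} → w ∈ₛ S′ → w ∈ₛ S) →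
    IsChordlessPath G S → IsChordlessPath G S′
  chordlessPath-resp S⊆S′ S′⊆S c = record
    { len = len ; f = f ; inj = inj
    ; onto = λ v → mk⇔ (to (onto v) ∘ S′⊆S) (S⊆S′ ∘ from (onto v))
    ; adjIff = adjIff }
    where open IsChordlessPath c

  chordlessPath-singleton : ∀ {S} v → v ∈ₛ S → (∀ {w} → w ∈ₛ S → w ≡ v) → PathFrom {S} v
  chordlessPath-singleton {S} v v∈S only = record
    { len = 0 ; f = λ _ → v
    ; inj = λ { zero zero _ → refl }
    ; onto = λ w → mk⇔ (λ w∈S → zero , ≡-sym (only w∈S)) λ (_ , v≡w) → subst (_∈ₛ S) v≡w v∈S
    ; adjIff = λ { zero zero → mk⇔ (λ e → contradiction refl (Adj⇒≢ e)) λ { (inj₁ ()) ; (inj₂ ()) } }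
    } , refl

  chordlessPath-extend : ∀ {S S′ u v} → PathFrom {S} u → Adj G v u → ¬ v ∈ₛ S →
    (∀ {w} → w ∈ₛ S → Adj G v w → w ≡ u) →
    (∀ {w} → w ∈ₛ S′ → w ≡ v ⊎ w ∈ₛ S) → (∀ {w} → w ≡ v ⊎ w ∈ₛ S → w ∈ₛ S′) →
    PathFrom {S′} v
  chordlessPath-extend {S} {S′} {u} {v} (c , refl) e v∉S only S′⁻ S′⁺ = record
    { len = suc len ; f = g ; inj = g-inj ; onto = g-onto ; adjIff = g-adj } , refl
    where
    open IsChordlessPath c
    f-∈ : ∀ i → f i ∈ₛ S
    f-∈ i = from (onto _) (i , refl)

    g : Fin (suc (suc len)) → Fin (n G)
    g zero    = v
    g (suc i) = f i

    g-inj : ∀ i j → g i ≡ g j → i ≡ j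
    g-inj zero zero _ = refl
    g-inj zero (suc j) eq = contradiction (subst (_∈ₛ S) (≡-sym eq) (f-∈ j)) v∉S
    g-inj (suc i) zero eq = contradiction (subst (_∈ₛ S) eq (f-∈ i)) v∉S
    g-inj (suc i) (suc j) eq = cong suc (inj i j eq)

    g-onto : ∀ w → w ∈ₛ S′ ⇔ (∃[ i ] g i ≡ w)
    g-onto w = mk⇔
      (λ w∈S′ → [ (λ w≡v → zero , ≡-sym w≡v)
                , (λ w∈S → let i , eq = to (onto w) w∈S in suc i , eq) ]′ (S′⁻ w∈S′))
      λ { (zero , refl) → S′⁺ (inj₁ refl) ; (suc i , refl) → S′⁺ (inj₂ (f-∈ i)) }

    v-adj : ∀ j → Adj G v (f j) ⇔ 0 ≡ toℕ j
    v-adj j = mk⇔ (λ ej → cong toℕ (≡-sym (inj j zero (only (f-∈ j) ej))))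
      (λ 0≡j → subst (λ i → Adj G v (f i)) (toℕ-injective {i = zero} 0≡j) e)

    g-adj : ∀ i j → Adj G (g i) (g j) ⇔ ((suc (toℕ i) ≡ toℕ j) ⊎ (suc (toℕ j) ≡ toℕ i))
    g-adj zero zero = mk⇔ (λ e → contradiction refl (Adj⇒≢ e)) λ { (inj₁ ()) ; (inj₂ ()) }
    g-adj zero (suc j) = mk⇔ (inj₁ ∘ cong suc ∘ to (v-adj j))
      λ { (inj₁ eq) → from (v-adj j) (suc-injective eq) ; (inj₂ ()) }
    g-adj (suc i) zero = mk⇔ (inj₂ ∘ cong suc ∘ to (v-adj i) ∘ Adj-sym)
      λ { (inj₁ ()) ; (inj₂ eq) → Adj-sym (from (v-adj i) (suc-injective eq)) }
    g-adj (suc i) (suc j) = mk⇔ (⊎-map (cong suc) (cong suc) ∘ to (adjIff i j))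
      (from (adjIff i j) ∘ ⊎-map suc-injective suc-injective)

  chordlessPath-shrink : ∀ {S S′ u x} → PathFrom {S} u → x ∈ₛ S → x ≢ u →
    (∀ {w} → w ∈ₛ S′ → w ∈ₛ S × w ≢ u) → (∀ {w} → w ∈ₛ S → w ≢ u → w ∈ₛ S′) →
    IsChordlessPath G S′
  chordlessPath-shrink (record { len = zero ; onto = onto } , refl) x∈S x≢f₀ _ _
    with zero , refl ← to (onto _) x∈S = contradiction refl x≢f₀
  chordlessPath-shrink {S′ = S′}
    (record { len = suc len ; f = f ; inj = inj ; onto = onto ; adjIff = adjIff } , refl) _ _ S′⁻ S′⁺ = record
    { len = len ; f = f ∘ suc
    ; inj = λ i j eq → Fin-suc-injective (inj _ _ eq)
    ; onto = λ w → mk⇔ (fwd w) λ { (i , refl) → S′⁺ (from (onto _) (suc i , refl)) λ eq → contradiction (inj _ _ eq) λ () }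
    ; adjIff = λ i j → mk⇔ (⊎-map suc-injective suc-injective ∘ to (adjIff _ _))
        (from (adjIff _ _) ∘ ⊎-map (cong suc) (cong suc)) }
    where
    fwd : ∀ w → w ∈ₛ S′ → ∃[ i ] f (suc i) ≡ w
    fwd w w∈S′ with w∈S , w≢ ← S′⁻ w∈S′ | to (onto w) (proj₁ (S′⁻ w∈S′))
    ... | zero , eq  = contradiction (≡-sym eq) w≢
    ... | suc i , eq = i , eq

  -- Paths, walks and cycles

  pathIn⇒walk : ∀ {S a b} → PathIn G S a b → Star (Adj G ↾ (_∈ₛ S)) a b
  pathIn⇒walk {S} record { len = len ; f = f ; inS = inS ; start = i , i≡0 , refl ; end = j , j≡len , refl ; step = step } =
    subst₂ (λ s t → Star (Adj G ↾ (_∈ₛ S)) (f s) (f t))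
      (toℕ-injective (≡-sym i≡0)) (toℕ-injective (trans (toℕ-fromℕ len) (≡-sym j≡len)))
      (walk len f inS step)
    where
    walk : ∀ k (f : Fin (suc k) → Fin (n G)) → (∀ i → f i ∈ₛ S) →
      (∀ i j → suc (toℕ i) ≡ toℕ j → Adj G (f i) (f j)) → Star (Adj G ↾ (_∈ₛ S)) (f zero) (f (fromℕ k))
    walk zero f inS step = ε
    walk (suc k) f inS step = (step zero (suc zero) refl , inS _ , inS _) ◅
      walk k (f ∘ suc) (inS ∘ suc) (λ i j eq → step _ _ (cong suc eq))

  walk⇒pathIn : ∀ {S a b} → a ∈ₛ S → Star (Adj G ↾ (_∈ₛ S)) a b → PathIn G S a b
  walk⇒pathIn {S} a∈S s with p , p⊆S ← loopErase {S = _∈ₛ S} a∈S s = record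
    { len = size p ; f = at p ; inj = at-injective p ; inS = λ i → p⊆S (at-∈ p i)
    ; start = zero , refl , at-first p
    ; end = fromℕ (size p) , toℕ-fromℕ (size p) , at-last p _ (toℕ-fromℕ (size p))
    ; step = at-step p }

  -- The cycle closes `r` through `x`. The neighbours of `x` on it are the ends of `r`, and `y` lies
  -- on `r` but is neither of them; this also forces an edge in `r`, whence at least three vertices.
  cycle-chord : ∀ {x y x₁ x₂} → Adj G x y → Adj G x x₁ → Adj G x x₂ → x₁ ≢ y → x₂ ≢ y →
    (r : SPath (Adj G) x₁ x₂) → ¬ x ∈ᵖ r → y ∈ᵖ r → Σ (Cycle G) (HasChord G)
  cycle-chord {x} {y} {x₁} {x₂} e e₁ e₂ x₁≢y x₂≢y r x∉r y∈r =
    record { len = suc (suc (size r)) ; len≥3 = s≤s (s≤s (nontrivial r y∈r)) ; f = at c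
           ; inj = at-injective c ; step = step } ,
    chord (∈-at r y∈r)
    where
    c : SPath (Adj G) x x₂
    c = cons e₁ r x∉r

    nontrivial : ∀ {x₂} (r : SPath (Adj G) x₁ x₂) → y ∈ᵖ r → 1 ≤ size r
    nontrivial [ _ ] y≡x₁ = contradiction (≡-sym y≡x₁) x₁≢y
    nontrivial (cons _ _ _) _ = s≤s z≤n

    step : ∀ i j → CycNext (suc (suc (size r))) i j → Adj G (at c i) (at c j)
    step i j (inj₁ eq) = at-step c i j eq
    step i zero (inj₂ (eq , _)) = subst (λ s → Adj G s x) (≡-sym (at-last c i (suc-injective eq))) (Adj-sym e₂)

    chord : ∃[ k ] at r k ≡ y → ∃[ i ] ∃[ j ] (Adj G (at c i) (at c j) ×
      ¬ CycNext (suc (suc (size r))) i j × ¬ CycNext (suc (suc (size r))) j i)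
    chord (k , refl) = zero , suc k , e ,
      (λ { (inj₁ eq) → x₁≢y (trans (≡-sym (at-first r)) (cong (at r) (toℕ-injective (suc-injective eq))))
         ; (inj₂ (_ , ())) }) ,
      (λ { (inj₁ ()) ; (inj₂ (eq , _)) → x₂≢y (≡-sym (at-last r k (suc-injective (suc-injective eq)))) })

  -- The edge `xy` and the two routes through `x₁` and `x₂` form a theta graph. The cycle runs from
  -- `x` along `p` to `y` and back along the reverse of `q`, and `xy` is its chord.
  noTheta : Chordless G → ∀ {x y x₁ x₂} → Adj G x y → Adj G x x₁ → Adj G x x₂ → x₁ ≢ y → x₂ ≢ y →
    (p : SPath (Adj G) x₁ y) (q : SPath (Adj G) x₂ y) → ¬ x ∈ᵖ p → ¬ x ∈ᵖ q →
    (∀ {w} → w ∈ᵖ p → w ∈ᵖ q → w ≡ y) → ⊥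
  noTheta chordless {x} {y} {x₁} {x₂} e e₁ e₂ x₁≢y x₂≢y p q x∉p x∉q meet
    with q̄ , q̄⊆ ← reverse-append Adj-sym q [ x₂ ] (λ _ → id)
    = let r , r⊆ , p⊆r = append p q̄ (λ w∈p w∈q̄ → meet w∈p (q̄⊆q w∈q̄))
          C , chord = cycle-chord e e₁ e₂ x₁≢y x₂≢y r
                        (λ x∈r → [ x∉p , x∉q ∘ q̄⊆q ]′ (r⊆ x∈r)) (p⊆r (last∈ p))
      in chordless C chord
    where
    q̄⊆q : ∀ {w} → w ∈ᵖ q̄ → w ∈ᵖ q
    q̄⊆q w∈q̄ = [ id , (λ { refl → first∈ q }) ]′ (q̄⊆ w∈q̄)

  -- Two-connected graphs

  avoiding : TwoConnected G → ∀ v {x y} → x ≢ v → y ≢ v → Star (Adj G ↾ (_≢ v)) x y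
  avoiding (_ , _ , conn) v x≢v y≢v = ↾-mono ≢⁻ (pathIn⇒walk (conn v _ _ (≢⁺ x≢v) (≢⁺ y≢v)))

  firstStep : ∀ {S : Fin (n G) → Set} {x y} → x ≢ y → Star (Adj G ↾ S) x y → ∃[ w ] Adj G x w × S w
  firstStep x≢y ε = contradiction refl x≢y
  firstStep x≢y ((e , _ , sw) ◅ _) = _ , e , sw

  third : TwoConnected G → ∀ v x → ∃[ w ] w ≢ v × w ≢ x
  third (3≤n , _) v x = let w , (_ , w≢v) , w≢x = Two-avoid (Three-avoid (three 3≤n) v) x in w , w≢v , w≢x
    where
    three : ∀ {m} → 3 ≤ m → Three {Fin m} (λ w → w ≡ w)
    three (s≤s (s≤s (s≤s _))) =
      zero , suc zero , suc (suc zero) , (refl , refl , refl) , (λ ()) , (λ ()) , (λ ())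

  -- Once a neighbour `y` is known, a walk from `v` that avoids `y` begins with a second one.
  twoNbrs : TwoConnected G → ∀ v → Two (Adj G v)
  twoNbrs tc v
    with x , x≢v , _ ← third tc v v
    with t , t≢v , t≢x ← third tc v x
    with y , ey , _ ← firstStep (x≢v ∘ ≡-sym) (avoiding tc t (t≢v ∘ ≡-sym) (t≢x ∘ ≡-sym))
    with w , w≢v , w≢y ← third tc v y
    with y′ , ey′ , y′≢y ← firstStep (w≢v ∘ ≡-sym) (avoiding tc y (Adj⇒≢ ey) w≢y)
    = y , y′ , (ey , ey′) , y′≢y ∘ ≡-sym

-- Splits

module _ {G : Graph} where

  split-swapXY : ∀ {X Y a b} → Split G X Y a b → Split G Y X a b
  split-swapXY s = record
    { a≢b = a≢b ; nonadj = nonadj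
    ; cover = λ v → [ inj₂ ∘ inj₁ , [ inj₁ , inj₂ ∘ inj₂ ]′ ]′ (cover v)
    ; XY-disj = λ v v∈Y v∈X → XY-disj v v∈X v∈Y
    ; a∉X = a∉Y ; b∉X = b∉Y ; a∉Y = a∉X ; b∉Y = b∉X ; X≠∅ = Y≠∅ ; Y≠∅ = X≠∅
    ; noEdge = λ y x y∈Y x∈X e → noEdge x y x∈X y∈Y (Adj-sym {G} e)
    ; pathX = pathY ; pathY = pathX ; notPathX = notPathY ; notPathY = notPathX }
    where open Split s

  pathIn-reverse : ∀ X {a b} → PathIn G ((X ∪ab) (a , b)) a b → PathIn G ((X ∪ab) (b , a)) b a
  pathIn-reverse X {a} {b} p = walk⇒pathIn (∪ab⁺ X b a (inj₂ (inj₁ refl)))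
    (↾-mono (∪ab-comm X a b) (reverse (λ (e , sx , sy) → Adj-sym {G} e , sy , sx) (pathIn⇒walk p)))

  split-swapAB : ∀ {X Y a b} → Split G X Y a b → Split G X Y b a
  split-swapAB {X} {Y} {a} {b} s = record
    { a≢b = a≢b ∘ ≡-sym ; nonadj = nonadj ∘ Adj-sym {G}
    ; cover = λ v → ⊎-map id (⊎-map id swap) (cover v)
    ; XY-disj = XY-disj
    ; a∉X = b∉X ; b∉X = a∉X ; a∉Y = b∉Y ; b∉Y = a∉Y ; X≠∅ = X≠∅ ; Y≠∅ = Y≠∅
    ; noEdge = noEdge
    ; pathX = pathIn-reverse X pathX ; pathY = pathIn-reverse Y pathY
    ; notPathX = notPathX ∘ chordlessPath-resp (∪ab-comm X b a) (∪ab-comm X a b)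
    ; notPathY = notPathY ∘ chordlessPath-resp (∪ab-comm Y b a) (∪ab-comm Y a b) }
    where open Split s

  module _ {X Y a b} (s : Split G X Y a b) where
    open Split s

    walkX : Star (Adj G ↾ InX∪ X a b) a b
    walkX = ↾-mono (∪ab⁻ X a b) (pathIn⇒walk pathX)

    nbrsX-closed : ∀ {x w} → x ∈ₛ X → Adj G x w → InX∪ X a b w
    nbrsX-closed {x} {w} x∈X e with cover w
    ... | inj₁ w∈X        = inj₁ w∈X
    ... | inj₂ (inj₁ w∈Y) = contradiction e (noEdge x w x∈X w∈Y)
    ... | inj₂ (inj₂ w≡)  = inj₂ w≡

    nbrInX : ∃[ x ] Adj G a x × x ∈ₛ X
    nbrInX with firstStep {G} a≢b walkX
    ... | x , e , inj₁ x∈X         = x , e , x∈X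
    ... | x , e , inj₂ (inj₁ refl) = contradiction refl (Adj⇒≢ {G} e)
    ... | x , e , inj₂ (inj₂ refl) = contradiction e nonadj

    -- In `G` without `b`, the set `X` can be left only through `a`.
    walkToA : TwoConnected G → ∀ {x} → x ∈ₛ X → Star (Adj G ↾ (λ w → w ∈ₛ X ⊎ w ≡ a)) x a
    walkToA tc x∈X = until
      (λ s∈X e _ t≢b → [ inj₁ , [ inj₂ , (λ t≡b → contradiction t≡b t≢b) ]′ ]′ (nbrsX-closed s∈X e))
      x∈X (avoiding tc b (λ { refl → b∉X x∈X }) a≢b)

  -- The end a of the split slides to its unique neighbour a′ in X.
  module _ (tc : TwoConnected G) (chordless : Chordless G) {X Y a b} (s : Split G X Y a b)
      {a′} (a′∈X : a′ ∈ₛ X) (aa′ : Adj G a a′) (unique : ∀ {x} → x ∈ₛ X → Adj G a x → x ≡ a′) where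
    open Split s

    private
      a≢a′ : a ≢ a′
      a≢a′ refl = a∉X a′∈X

      b≢a′ : b ≢ a′
      b≢a′ refl = b∉X a′∈X

      nbrs-X∖a′ : ∀ {x w} → x ∈ₛ X → x ≢ a′ → Adj G x w → w ∈ₛ X ⊎ w ≡ b
      nbrs-X∖a′ x∈X x≢a′ e with nbrsX-closed s x∈X e
      ... | inj₁ w∈X         = inj₁ w∈X
      ... | inj₂ (inj₁ refl) = contradiction (unique x∈X (Adj-sym {G} e)) x≢a′
      ... | inj₂ (inj₂ w≡b)  = inj₂ w≡b

      X∪b⁺ : ∀ {w} → w ∈ₛ X ⊎ w ≡ b → InX∪ (X ∖ a′) a′ b w
      X∪b⁺ (inj₂ w≡b) = inj₂ (inj₂ w≡b)
      X∪b⁺ {w} (inj₁ w∈X) = case w ≟ a′ of λ where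
        (yes w≡a′) → inj₂ (inj₁ w≡a′)
        (no w≢a′)  → inj₁ (∖⁺ X w∈X w≢a′)

      X∪b⁻ : ∀ {w} → InX∪ (X ∖ a′) a′ b w → w ∈ₛ X ⊎ w ≡ b
      X∪b⁻ (inj₁ w∈)         = inj₁ (proj₁ (∖⁻ X w∈))
      X∪b⁻ (inj₂ (inj₁ refl)) = inj₁ a′∈X
      X∪b⁻ (inj₂ (inj₂ w≡b)) = inj₂ w≡b

      extend-a : PathFrom {G} {X ∪₁ b} a′ → PathFrom {G} {(X ∪ab) (a , b)} a
      extend-a c = chordlessPath-extend c aa′
        (λ a∈ → [ a∉X , a≢b ]′ (∪₁⁻ X a∈))
        (λ w∈ e → [ (λ w∈X → unique w∈X e) , (λ { refl → contradiction e nonadj }) ]′ (∪₁⁻ X w∈))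
        (λ w∈ → [ inj₂ ∘ ∪₁⁺ X ∘ inj₁ , [ inj₁ , inj₂ ∘ ∪₁⁺ X ∘ inj₂ ]′ ]′ (∪ab⁻ X a b w∈))
        (λ w∈ → ∪ab⁺ X a b ([ inj₂ ∘ inj₁ , [ inj₁ , inj₂ ∘ inj₂ ]′ ∘ ∪₁⁻ X ]′ w∈))

      -- If `X` is just `a′`, the edge would make `a a′ b` a chordless path on all of `X ∪ {a,b}`.
      -- Otherwise `a′` has a neighbour `x₁` in `X`, and the cycle goes from `a′` over `x₁` through
      -- `X` to `b`, then through `Y` to `a` and back to `a′`.
      slide-nonadj : ¬ Adj G a′ b
      slide-nonadj e with any? (λ x → (x ∈? X) ×-dec ¬? (x ≟ a′))
      ... | no only = notPathX (proj₁ path₃)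
        where
        X≡a′ : ∀ {x} → x ∈ₛ X → x ≡ a′
        X≡a′ {x} x∈X = decidable-stable (x ≟ a′) λ x≢a′ → only (x , x∈X , x≢a′)

        -- The singleton of `b` is the empty set extended by `∪₁ b`, by computation; hence the
        -- `λ _ → false` in the uses of `∪₁⁺` and `∪₁⁻`.
        path₁ : PathFrom {G} {λ w → ⌊ w ≟ b ⌋} b
        path₁ = chordlessPath-singleton b (≟-true b) λ {w} w∈ → [ (λ ()) , id ]′ (∪₁⁻ (λ _ → false) {b} {w} w∈)

        path₂ : PathFrom {G} {X ∪₁ b} a′
        path₂ = chordlessPath-extend path₁ e (λ a′∈ → [ (λ ()) , b≢a′ ∘ ≡-sym ]′ (∪₁⁻ (λ _ → false) {b} {a′} a′∈))
          (λ {w} w∈ _ → [ (λ ()) , id ]′ (∪₁⁻ (λ _ → false) {b} {w} w∈))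
          (λ w∈ → [ inj₁ ∘ X≡a′ , (λ w≡b → inj₂ (∪₁⁺ (λ _ → false) (inj₂ w≡b))) ]′ (∪₁⁻ X w∈))
          (λ {w} → [ (λ { refl → ∪₁⁺ X (inj₁ a′∈X) }) , (λ w∈ → [ (λ ()) , ∪₁⁺ X ∘ inj₂ ]′ (∪₁⁻ (λ _ → false) {b} {w} w∈)) ]′)

        path₃ : PathFrom {G} {(X ∪ab) (a , b)} a
        path₃ = extend-a path₂
      ... | yes (x , x∈X , x≢a′)
        -- A walk from `x` to `a′` that avoids `b` can leave `X ∖ a′` only into `a′`, since `a` has
        -- no neighbour there; the vertex before the exit is the wanted `x₁`.
        with x₁ , t , (x₁∈X , x₁≢a′) , t∉ , x₁t , _ , t≢b ← boundary (λ w → (w ∈? X) ×-dec ¬? (w ≟ a′))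
               (x∈X , x≢a′) (λ (_ , a′≢a′) → a′≢a′ refl)
               (avoiding {G} tc b {y = a′} (λ { refl → b∉X x∈X }) (b≢a′ ∘ ≡-sym))
        = noTheta chordless e (Adj-sym {G} (subst (Adj G x₁) t≡a′ x₁t)) (Adj-sym {G} aa′)
            (λ { refl → b∉X x₁∈X }) a≢b p q a′∉p a′∉q meet
        where
        t≡a′ : t ≡ a′
        t≡a′ with nbrs-X∖a′ x₁∈X x₁≢a′ x₁t
        ... | inj₁ t∈X = decidable-stable (t ≟ a′) λ t≢a′ → t∉ (t∈X , t≢a′)
        ... | inj₂ t≡b = contradiction t≡b t≢b

        through-X : Σ (SPath (Adj G) x₁ b) λ p → ∀ {w} → w ∈ᵖ p → (w ∈ₛ X × w ≢ a′) ⊎ w ≡ b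
        through-X = loopErase (inj₁ (x₁∈X , x₁≢a′)) (until
          (λ (s∈X , s≢a′) e _ t≢a′ → ⊎-map (_, t≢a′) id (nbrs-X∖a′ s∈X s≢a′ e))
          (x₁∈X , x₁≢a′) (avoiding {G} tc a′ x₁≢a′ b≢a′))

        through-Y : Σ (SPath (Adj G) a b) λ q → ∀ {w} → w ∈ᵖ q → InX∪ Y a b w
        through-Y = loopErase (inj₂ (inj₁ refl)) (walkX (split-swapXY s))

        p = proj₁ through-X
        q = proj₁ through-Y

        a′∉p : ¬ a′ ∈ᵖ p
        a′∉p a′∈p = [ (λ (_ , a′≢a′) → a′≢a′ refl) , b≢a′ ∘ ≡-sym ]′ (proj₂ through-X a′∈p)

        a′∉q : ¬ a′ ∈ᵖ q
        a′∉q a′∈q = [ XY-disj a′ a′∈X , [ a≢a′ ∘ ≡-sym , b≢a′ ∘ ≡-sym ]′ ]′ (proj₂ through-Y a′∈q)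

        meet : ∀ {w} → w ∈ᵖ p → w ∈ᵖ q → w ≡ b
        meet {w} w∈p w∈q with proj₂ through-X w∈p | proj₂ through-Y w∈q
        ... | inj₂ w≡b | _ = w≡b
        ... | inj₁ (w∈X , _) | inj₁ w∈Y = contradiction w∈Y (XY-disj w w∈X)
        ... | inj₁ (w∈X , _) | inj₂ (inj₁ refl) = contradiction w∈X a∉X
        ... | inj₁ _ | inj₂ (inj₂ w≡b) = w≡b

      -- On a walk from `a` to `b` within `X ∪ {a,b}`, the pair `a`, `a′` can be left only from
      -- `a′`, and not directly to `b`; so the exit leads to another vertex of `X`.
      slide-nonempty : ∃[ x ] x ∈ₛ (X ∖ a′)
      slide-nonempty
        with boundary (λ w → (w ≟ a) ⊎-dec (w ≟ a′)) (inj₁ refl) [ a≢b ∘ ≡-sym , b≢a′ ]′ (walkX s)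
      ... | _ , t , inj₁ refl , t∉ , e , _ , inj₁ t∈X          = contradiction (inj₂ (unique t∈X e)) t∉
      ... | _ , t , inj₁ refl , t∉ , e , _ , inj₂ (inj₂ refl)  = contradiction e nonadj
      ... | _ , t , _         , t∉ , e , _ , inj₂ (inj₁ refl)  = contradiction (inj₁ refl) t∉
      ... | _ , t , inj₂ refl , t∉ , e , _ , inj₁ t∈X          = t , ∖⁺ X t∈X (t∉ ∘ inj₂)
      ... | _ , t , inj₂ refl , t∉ , e , _ , inj₂ (inj₂ refl)  = contradiction e slide-nonadj

      X∪b-∈⁺ : ∀ w → w ∈ₛ X ⊎ w ≡ b → w ∈ₛ ((X ∖ a′) ∪ab) (a′ , b)
      X∪b-∈⁺ w w∈ = ∪ab⁺ (X ∖ a′) a′ b {w} (X∪b⁺ w∈)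

      X∪b-∈⁻ : ∀ w → w ∈ₛ ((X ∖ a′) ∪ab) (a′ , b) → w ∈ₛ X ⊎ w ≡ b
      X∪b-∈⁻ w w∈ = X∪b⁻ (∪ab⁻ (X ∖ a′) a′ b {w} w∈)

      -- Take an end other than `b`. If it is `a′`, prepending `a` gives a chordless path on
      -- `X ∪ {a,b}`. If not, it has all its neighbours in the set, and these are at least two.
      slide-notPathX : ¬ IsChordlessPath G (((X ∖ a′) ∪ab) (a′ , b))
      slide-notPathX c₀ with start-≢ c₀ {a′} {b} (X∪b-∈⁺ a′ (inj₁ a′∈X)) (b≢a′ ∘ ≡-sym)
      ... | c , f₀≢b with first c ≟ a′
      ... | yes f₀≡a′ = notPathX (proj₁ (extend-a
        (chordlessPath-resp (λ {w} → ∪₁⁺ X {b} {w} ∘ X∪b-∈⁻ w) (λ {w} → X∪b-∈⁺ w ∘ ∪₁⁻ X {b} {w}) c , f₀≡a′)))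
      ... | no f₀≢a′ = let x , y , (ex , ey) , x≢y = twoNbrs {G} tc (first c) in
        x≢y (first-nbr-unique c {x} {y} (nbr∈ x ex) (nbr∈ y ey) ex ey)
        where
        f₀∈X : first c ∈ₛ X
        f₀∈X = [ id , (λ f₀≡b → contradiction f₀≡b f₀≢b) ]′ (X∪b-∈⁻ (first c) (first-∈ c))

        nbr∈ : ∀ w → Adj G (first c) w → w ∈ₛ ((X ∖ a′) ∪ab) (a′ , b)
        nbr∈ w e = X∪b-∈⁺ w (nbrs-X∖a′ f₀∈X f₀≢a′ e)

      nbr≡a : ∀ {w} → w ∈ₛ ((Y ∪₁ a) ∪ab) (a′ , b) → Adj G a′ w → w ≡ a
      nbr≡a {w} w∈ e = [ [ (λ w∈Y → contradiction e (noEdge a′ w a′∈X w∈Y)) , id ]′ ∘ ∪₁⁻ Y {a} {w}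
        , [ (λ w≡a′ → contradiction (≡-sym w≡a′) (Adj⇒≢ {G} e))
          , (λ w≡b → contradiction (subst (Adj G a′) w≡b e) slide-nonadj) ]′ ]′ (∪ab⁻ (Y ∪₁ a) a′ b {w} w∈)

      -- The only neighbour of `a′` in this set is `a`, so `a′` would be an end of the path, and
      -- deleting it would leave a chordless path on `Y ∪ {a,b}`.
      slide-notPathY : ¬ IsChordlessPath G (((Y ∪₁ a) ∪ab) (a′ , b))
      slide-notPathY c₀ = notPathY (chordlessPath-shrink {x = a}
          (start-at c₀ {a′} (∪ab⁺ (Y ∪₁ a) a′ b {a′} (inj₂ (inj₁ refl)))
            (λ {x} {y} x∈ y∈ ex ey → trans (nbr≡a {x} x∈ ex) (≡-sym (nbr≡a {y} y∈ ey))))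
          (∪ab⁺ (Y ∪₁ a) a′ b {a} (inj₁ (∪₁⁺ Y {a} {a} (inj₂ refl)))) a≢a′
          (λ {w} w∈ → let w∈′ = ∪ab⁻ Y a b {w} w∈ in
            ∪ab⁺ (Y ∪₁ a) a′ b {w} ([ inj₁ ∘ ∪₁⁺ Y {a} {w} ∘ inj₁ , [ inj₁ ∘ ∪₁⁺ Y {a} {w} ∘ inj₂ , inj₂ ∘ inj₂ ]′ ]′ w∈′) ,
            λ { refl → [ XY-disj a′ a′∈X , [ a≢a′ ∘ ≡-sym , b≢a′ ∘ ≡-sym ]′ ]′ w∈′ })
          (λ {w} w∈ w≢a′ → ∪ab⁺ Y a b
            ([ [ inj₁ , inj₂ ∘ inj₁ ]′ ∘ ∪₁⁻ Y {a} {w} , [ (λ w≡a′ → contradiction w≡a′ w≢a′) , inj₂ ∘ inj₂ ]′ ]′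
              (∪ab⁻ (Y ∪₁ a) a′ b {w} w∈))))

    slide : Split G (X ∖ a′) (Y ∪₁ a) a′ b
    slide = record
      { a≢b = b≢a′ ∘ ≡-sym ; nonadj = slide-nonadj
      ; cover = cover′
      ; XY-disj = λ v v∈X′ v∈Y′ → let v∈X , _ = ∖⁻ X v∈X′ in
          [ XY-disj v v∈X , (λ { refl → a∉X v∈X }) ]′ (∪₁⁻ Y v∈Y′)
      ; a∉X = λ a′∈ → proj₂ (∖⁻ X a′∈) refl
      ; b∉X = λ b∈ → b∉X (proj₁ (∖⁻ X b∈))
      ; a∉Y = λ a′∈ → [ XY-disj a′ a′∈X , a≢a′ ∘ ≡-sym ]′ (∪₁⁻ Y a′∈)
      ; b∉Y = λ b∈ → [ b∉Y , a≢b ∘ ≡-sym ]′ (∪₁⁻ Y b∈)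
      ; X≠∅ = slide-nonempty
      ; Y≠∅ = a , ∪₁⁺ Y (inj₂ refl)
      ; noEdge = λ x y x∈X′ y∈Y′ e → let x∈X , x≢a′ = ∖⁻ X x∈X′ in
          [ (λ y∈Y → noEdge x y x∈X y∈Y e)
          , (λ { refl → x≢a′ (unique x∈X (Adj-sym {G} e)) }) ]′ (∪₁⁻ Y y∈Y′)
      ; pathX = walk⇒pathIn (X∪b-∈⁺ a′ (inj₁ a′∈X))
          (↾-mono (λ {w} → X∪b-∈⁺ w) (walkToA (split-swapAB s) tc a′∈X))
      ; pathY = walk⇒pathIn (∪ab⁺ (Y ∪₁ a) a′ b {a′} (inj₂ (inj₁ refl)))
          ((Adj-sym {G} aa′ , ∪ab⁺ (Y ∪₁ a) a′ b {a′} (inj₂ (inj₁ refl)) , Y∪ab⊆ (inj₂ (inj₁ refl))) ◅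
           ↾-mono Y∪ab⊆ (walkX (split-swapXY s)))
      ; notPathX = slide-notPathX ; notPathY = slide-notPathY }
      where
      Y∪ab⊆ : ∀ {w} → InX∪ Y a b w → w ∈ₛ ((Y ∪₁ a) ∪ab) (a′ , b)
      Y∪ab⊆ {w} w∈ = ∪ab⁺ (Y ∪₁ a) a′ b {w} ([ inj₁ ∘ ∪₁⁺ Y {a} {w} ∘ inj₁ , [ inj₁ ∘ ∪₁⁺ Y {a} {w} ∘ inj₂ , inj₂ ∘ inj₂ ]′ ]′ w∈)

      cover′ : ∀ v → v ∈ₛ (X ∖ a′) ⊎ v ∈ₛ (Y ∪₁ a) ⊎ v ≡ a′ ⊎ v ≡ b
      cover′ v with cover v
      ... | inj₁ v∈X = [ inj₁ , inj₂ ∘ inj₂ ]′ (X∪b⁺ (inj₁ v∈X))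
      ... | inj₂ (inj₁ v∈Y) = inj₂ (inj₁ (∪₁⁺ Y (inj₁ v∈Y)))
      ... | inj₂ (inj₂ (inj₁ v≡a)) = inj₂ (inj₁ (∪₁⁺ Y (inj₂ v≡a)))
      ... | inj₂ (inj₂ (inj₂ v≡b)) = inj₂ (inj₂ (inj₂ v≡b))

-- Cuts by an edge and a vertex

-- In other words, `uv` is a bridge of `G` minus `z`, with sides `P` and `Q`.
record EdgeCut (G : Graph) (u v z : Fin (n G)) (P Q : VSet (n G)) : Set where
  field
    edge     : Adj G u v
    u∈P      : u ∈ₛ P
    v∈Q      : v ∈ₛ Q
    z∉P      : ¬ z ∈ₛ P
    z∉Q      : ¬ z ∈ₛ Q
    disjoint : ∀ {w} → w ∈ₛ P → ¬ w ∈ₛ Q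
    cover    : ∀ w → w ∈ₛ P ⊎ w ∈ₛ Q ⊎ w ≡ z
    cross    : ∀ {s t} → s ∈ₛ P → t ∈ₛ Q → Adj G s t → s ≡ u × t ≡ v

module _ {G : Graph} where

  edgeCut-swap : ∀ {u v z P Q} → EdgeCut G u v z P Q → EdgeCut G v u z Q P
  edgeCut-swap K = record
    { edge = Adj-sym {G} edge ; u∈P = v∈Q ; v∈Q = u∈P ; z∉P = z∉Q ; z∉Q = z∉P
    ; disjoint = λ w∈Q w∈P → disjoint w∈P w∈Q
    ; cover = λ w → [ inj₂ ∘ inj₁ , [ inj₁ , inj₂ ∘ inj₂ ]′ ]′ (cover w)
    ; cross = λ s∈Q t∈P e → let t≡u , s≡v = cross t∈P s∈Q (Adj-sym {G} e) in s≡v , t≡u }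
    where open EdgeCut K

  module _ (tc : TwoConnected G) {u v z P Q} (K : EdgeCut G u v z P Q) where
    open EdgeCut K

    nbrsP : ∀ {s t} → s ∈ₛ P → Adj G s t → (t ∈ₛ P ⊎ t ≡ z) ⊎ (s ≡ u × t ≡ v)
    nbrsP {t = t} s∈P e with cover t
    ... | inj₁ t∈P        = inj₁ (inj₁ t∈P)
    ... | inj₂ (inj₁ t∈Q) = inj₂ (cross s∈P t∈Q e)
    ... | inj₂ (inj₂ t≡z) = inj₁ (inj₂ t≡z)

    nbrsU : ∀ {t} → Adj G u t → t ≢ v → t ∈ₛ P ⊎ t ≡ z
    nbrsU e t≢v = [ id , (λ (_ , t≡v) → contradiction t≡v t≢v) ]′ (nbrsP u∈P e)

    nbrsP∖u : ∀ {s t} → s ∈ₛ P → s ≢ u → Adj G s t → t ∈ₛ P ⊎ t ≡ z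
    nbrsP∖u s∈P s≢u e = [ id , (λ (s≡u , _) → contradiction s≡u s≢u) ]′ (nbrsP s∈P e)

    cut-u≢z : u ≢ z
    cut-u≢z refl = z∉P u∈P

    cut-v≢z : v ≢ z
    cut-v≢z refl = z∉Q v∈Q

    -- The only edge from `P` to `Q` ends at `v`, so a walk from `u` to `z` that avoids `v` leaves
    -- `P` only into `z`.
    walkP : Star (Adj G ↾ (λ w → w ∈ₛ P ⊎ w ≡ z)) u z
    walkP = until (λ s∈P e _ t≢v → [ id , (λ (_ , t≡v) → contradiction t≡v t≢v) ]′ (nbrsP s∈P e))
      u∈P (avoiding {G} tc v (Adj⇒≢ {G} edge) (cut-v≢z ∘ ≡-sym))

    P∪z⁺ : ∀ w → w ∈ₛ P ⊎ w ≡ z → InX∪ (P ∖ u) u z w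
    P∪z⁺ w (inj₂ w≡z) = inj₂ (inj₂ w≡z)
    P∪z⁺ w (inj₁ w∈P) = case w ≟ u of λ where
      (yes w≡u) → inj₂ (inj₁ w≡u)
      (no w≢u)  → inj₁ (∖⁺ P {u} {w} w∈P w≢u)

    P∪z⁻ : ∀ w → InX∪ (P ∖ u) u z w → w ∈ₛ P ⊎ w ≡ z
    P∪z⁻ w (inj₁ w∈)          = inj₁ (proj₁ (∖⁻ P {u} {w} w∈))
    P∪z⁻ w (inj₂ (inj₁ refl)) = inj₁ u∈P
    P∪z⁻ w (inj₂ (inj₂ w≡z))  = inj₂ w≡z

    nbrInP∖u : Three (Adj G u) → ∃[ w ] w ∈ₛ P × w ≢ u × w ≢ z × Adj G u w
    nbrInP∖u deg-u = let w , (uw , w≢v) , w≢z = Two-avoid (Three-avoid deg-u v) z in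
      w , [ id , (λ w≡z → contradiction w≡z w≢z) ]′ (nbrsU uw w≢v) , Adj⇒≢ {G} uw ∘ ≡-sym , w≢z , uw

    walkP∖u : ∀ {w} → w ∈ₛ P → w ≢ u →
      Σ (SPath (Adj G) w z) λ p → ∀ {x} → x ∈ᵖ p → (x ∈ₛ P × x ≢ u) ⊎ x ≡ z
    walkP∖u w∈P w≢u = loopErase (inj₁ (w∈P , w≢u)) (until
      (λ (s∈P , s≢u) e _ t≢u → ⊎-map (_, t≢u) id (nbrsP∖u s∈P s≢u e))
      (w∈P , w≢u) (avoiding {G} tc u w≢u (cut-u≢z ∘ ≡-sym)))

    -- A third neighbour `w` of `u` lies in `P` and reaches `z` inside `P ∪ z` without `u`.
    -- Continued by `z v u`, this closes a cycle with chord `uz`.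
    noTriangle : Chordless G → Three (Adj G u) → Adj G u z → ¬ Adj G v z
    noTriangle chordless deg-u uz vz =
      let w , w∈P , w≢u , w≢z , uw = nbrInP∖u deg-u
          p , p⊆ = walkP∖u w∈P w≢u
      in noTheta {G} chordless uz uw edge w≢z cut-v≢z p (cons vz [ z ] cut-v≢z)
          (λ u∈p → [ (λ (_ , u≢u) → u≢u refl) , cut-u≢z ]′ (p⊆ u∈p))
          [ Adj⇒≢ {G} edge , cut-u≢z ]′
          (λ { x∈p (inj₁ refl) → [ (λ (v∈P , _) → contradiction v∈Q (disjoint v∈P)) , id ]′ (p⊆ x∈p)
             ; _ (inj₂ x≡z) → x≡z })

    -- Only `u` can have a neighbour outside `P ∪ z`, namely `v`, and it has two others; the
    -- remaining vertices of `P` keep the two neighbours that 2-connectivity gives.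
    twoNbrsP : Three (Adj G u) → ∀ {s} → s ∈ₛ P → Two (λ x → (x ∈ₛ P ⊎ x ≡ z) × Adj G s x)
    twoNbrsP deg-u {s} s∈P with s ≟ u
    ... | yes refl = Two-map (λ (e , x≢v) → nbrsU e x≢v , e) (Three-avoid deg-u v)
    ... | no s≢u   = Two-map (λ e → nbrsP∖u s∈P s≢u e , e) (twoNbrs {G} tc s)

    cut-notPathP : Three (Adj G u) → ¬ IsChordlessPath G (((P ∖ u) ∪ab) (u , z))
    cut-notPathP deg-u c = low-degree-end c {u} {z} (∪ab⁺ (P ∖ u) u z {u} (inj₂ (inj₁ refl))) cut-u≢z
      λ {s} s∈ s≢z → Two-map (λ {w} (w∈ , e) → ∪ab⁺ (P ∖ u) u z {w} (P∪z⁺ w w∈) , e)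
        (twoNbrsP deg-u ([ id , (λ s≡z → contradiction s≡z s≢z) ]′ (P∪z⁻ s (∪ab⁻ (P ∖ u) u z {s} s∈))))

  edgeCut⇒split : TwoConnected G → ∀ {u v z P Q} → EdgeCut G u v z P Q →
    ¬ Adj G u z → Three (Adj G u) → Three (Adj G v) → Split G (P ∖ u) Q u z
  edgeCut⇒split tc {u} {v} {z} {P} {Q} K ¬uz deg-u deg-v = record
    { a≢b = cut-u≢z tc K ; nonadj = ¬uz
    ; cover = λ w → [ [ inj₁ , inj₂ ∘ inj₂ ]′ ∘ P∪z⁺ tc K w ∘ inj₁
                    , [ inj₂ ∘ inj₁ , inj₂ ∘ inj₂ ∘ inj₂ ]′ ]′ (cover w)
    ; XY-disj = λ w w∈ → disjoint (proj₁ (∖⁻ P {u} {w} w∈))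
    ; a∉X = λ u∈ → proj₂ (∖⁻ P {u} {u} u∈) refl
    ; b∉X = λ z∈ → z∉P (proj₁ (∖⁻ P {u} {z} z∈))
    ; a∉Y = disjoint u∈P
    ; b∉Y = z∉Q
    ; X≠∅ = let w , w∈P , w≢u , _ = nbrInP∖u tc K deg-u in w , ∖⁺ P {u} {w} w∈P w≢u
    ; Y≠∅ = v , v∈Q
    ; noEdge = λ x y x∈ y∈Q e → let x∈P , x≢u = ∖⁻ P {u} {x} x∈ in x≢u (proj₁ (cross x∈P y∈Q e))
    ; pathX = walk⇒pathIn (∪ab⁺ (P ∖ u) u z {u} (inj₂ (inj₁ refl)))
        (↾-mono (λ {w} w∈ → ∪ab⁺ (P ∖ u) u z {w} (P∪z⁺ tc K w w∈)) (walkP tc K))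
    ; pathY = walk⇒pathIn (∪ab⁺ Q u z (inj₂ (inj₁ refl)))
        ((edge , ∪ab⁺ Q u z (inj₂ (inj₁ refl)) , ∪ab⁺ Q u z (inj₁ v∈Q)) ◅
         ↾-mono (λ {w} w∈ → ∪ab⁺ Q u z {w} (⊎-map id inj₂ w∈)) (walkP tc (edgeCut-swap K)))
    ; notPathX = cut-notPathP tc K deg-u
    -- All neighbours of `v` lie in `Q ∪ {u,z}`, so `v` has at least three there.
    ; notPathY = λ c → no-three-nbrs c {v} (∪ab⁺ Q u z (inj₁ v∈Q)) (Three-map v-nbr deg-v) }
    where
    open EdgeCut K
    v-nbr : ∀ {w} → Adj G v w → w ∈ₛ (Q ∪ab) (u , z) × Adj G v w
    v-nbr {w} e = ∪ab⁺ Q u z {w} ([ ⊎-map id inj₂ , inj₂ ∘ inj₁ ∘ proj₂ ]′ (nbrsP tc (edgeCut-swap K) v∈Q e)) , e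

  module _ {X Y c d} (s : Split G X Y c d) {z} (z∉Y : ¬ z ∈ₛ Y) (z≢c : z ≢ c) where
    open Split s

    walkY-avoiding : TwoConnected G → ∀ {w} → InX∪ Y c d w → w ≢ z →
      Star (Adj G ↾ (λ x → InX∪ Y c d x × x ≢ z)) w c
    walkY-avoiding tc (inj₁ w∈Y) _ = ↾-mono
      [ (λ x∈Y → inj₁ x∈Y , λ { refl → z∉Y x∈Y }) , (λ x≡c → inj₂ (inj₁ x≡c) , λ { refl → z≢c x≡c }) ]′
      (walkToA (split-swapXY s) tc w∈Y)
    walkY-avoiding tc (inj₂ (inj₁ refl)) _ = ε
    walkY-avoiding tc (inj₂ (inj₂ refl)) d≢z = ↾-mono
      (λ x∈ → ⊎-map id swap x∈ , λ { refl → [ z∉Y , [ (λ z≡d → d≢z (≡-sym z≡d)) , z≢c ]′ ]′ x∈ })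
      (walkX (split-swapXY (split-swapAB s)))

    -- The vertices of `Y ∪ {c,d}` other than `z` are linked to `c` without leaving this set. The
    -- edge `uv` has an end in `X`, so it is on none of these walks, and the whole set stays on the
    -- side of `c`.
    edgeCut-oneSide : TwoConnected G → ∀ {u v P Q} → EdgeCut G u v z P Q → u ∈ₛ X ⊎ v ∈ₛ X →
      c ∈ₛ Q → ∀ w → w ∈ₛ P → w ∈ₛ X
    edgeCut-oneSide tc {u} {v} {P} {Q} K u∨v∈X c∈Q w w∈P with cover w
    ... | inj₁ w∈X = w∈X
    ... | inj₂ w∈  = contradiction c∈Q (disjoint (invariant stay
        (walkY-avoiding tc w∈ λ { refl → z∉P w∈P }) w∈P))
      where
      open EdgeCut K hiding (cover)

      X∩ : ∀ {x} → x ∈ₛ X → ¬ InX∪ Y c d x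
      X∩ {x} x∈X (inj₁ x∈Y)         = XY-disj x x∈X x∈Y
      X∩ x∈X     (inj₂ (inj₁ refl)) = a∉X x∈X
      X∩ x∈X     (inj₂ (inj₂ refl)) = b∉X x∈X

      stay : ∀ {x y} → (Adj G ↾ (λ x → InX∪ Y c d x × x ≢ z)) x y → x ∈ₛ P → y ∈ₛ P
      stay (e , (x∈ , _) , (y∈ , y≢z)) x∈P with nbrsP tc K x∈P e
      ... | inj₁ (inj₁ y∈P)    = y∈P
      ... | inj₁ (inj₂ y≡z)    = contradiction y≡z y≢z
      ... | inj₂ (refl , refl) = ⊥-elim ([ (λ u∈X → X∩ u∈X x∈) , (λ v∈X → X∩ v∈X y∈) ]′ u∨v∈X)

  -- Separating vertices of a graph with one edge deleted

  Minus : Fin (n G) → Fin (n G) → Fin (n G) → Fin (n G) → Set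
  Minus u v x y = Adj G x y × ¬ (x ≡ u × y ≡ v) × ¬ (x ≡ v × y ≡ u)

  Minus? : ∀ u v x y → Dec (Minus u v x y)
  Minus? u v x y = Adj? {G} x y ×-dec ¬? ((x ≟ u) ×-dec (y ≟ v)) ×-dec ¬? ((x ≟ v) ×-dec (y ≟ u))

  Minus-sym : ∀ {u v x y} → Minus u v x y → Minus u v y x
  Minus-sym (e , ¬uv , ¬vu) = Adj-sym {G} e , (λ (p , q) → ¬vu (q , p)) , (λ (p , q) → ¬uv (q , p))

  -- The sides are the set reached from `u` without `uv` and `z`, and the rest: an edge between them
  -- other than `uv` would extend the reached set.
  linked-or-cut : ∀ {u v z} → Adj G u v → z ≢ u → z ≢ v →
    Star (Minus u v ↾ (_≢ z)) u v ⊎ ∃₂ (EdgeCut G u v z)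
  linked-or-cut {u} {v} {z} uv z≢u z≢v
    with P , u∈P , walk , closed ← reachable {R = Minus u v ↾ (_≢ z)}
           (λ x y → Minus? u v x y ×-dec ¬? (x ≟ z) ×-dec ¬? (y ≟ z)) u
    with v ∈? P
  ... | yes v∈P = inj₁ (walk v∈P)
  ... | no v∉P = inj₂ (P , (not ∘ P) ∖ z , record
    { edge = uv ; u∈P = u∈P
    ; v∈Q = ∖⁺ (not ∘ P) {z} {v} (∉⁺ v∉P) (z≢v ∘ ≡-sym)
    ; z∉P = z∉P
    ; z∉Q = λ z∈ → proj₂ (∖⁻ (not ∘ P) {z} {z} z∈) refl
    ; disjoint = λ {w} w∈P w∈Q → ∉⁻ (proj₁ (∖⁻ (not ∘ P) {z} {w} w∈Q)) w∈P
    ; cover = cover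
    ; cross = cross })
    where
    ∉⁺ : ∀ {w} → ¬ w ∈ₛ P → not (P w) ≡ true
    ∉⁺ {w} w∉P with P w
    ... | true  = contradiction refl w∉P
    ... | false = refl

    ∉⁻ : ∀ {w} → not (P w) ≡ true → ¬ w ∈ₛ P
    ∉⁻ {w} t w∈P rewrite w∈P with () ← t

    z∉P : ¬ z ∈ₛ P
    z∉P z∈P = invariant {T = _≢ z} (λ (_ , _ , y≢z) _ → y≢z) (walk z∈P) (z≢u ∘ ≡-sym) refl

    cover : ∀ w → w ∈ₛ P ⊎ w ∈ₛ ((not ∘ P) ∖ z) ⊎ w ≡ z
    cover w = case ((w ∈? P) , (w ≟ z)) of λ where
      (yes w∈P , _)       → inj₁ w∈P
      (no _ , yes w≡z)    → inj₂ (inj₂ w≡z)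
      (no w∉P , no w≢z)   → inj₂ (inj₁ (∖⁺ (not ∘ P) {z} {w} (∉⁺ w∉P) w≢z))

    cross : ∀ {x y} → x ∈ₛ P → y ∈ₛ ((not ∘ P) ∖ z) → Adj G x y → x ≡ u × y ≡ v
    cross {x} {y} x∈P y∈Q e = decidable-stable ((x ≟ u) ×-dec (y ≟ v)) λ ¬uv →
      let y∉P , y≢z = ∖⁻ (not ∘ P) {z} {y} y∈Q in
      ∉⁻ y∉P (closed x∈P ((e , ¬uv , λ { (refl , _) → v∉P x∈P }) , (λ { refl → z∉P x∈P }) , y≢z))

  -- A walk avoiding c can meet Y only through d, so the excursions into Y contract to d.
  linked-Y : ∀ {X Y c d} → Split G X Y c d → ∀ {u v z} → z ∈ₛ Y → ¬ u ∈ₛ Y → ¬ v ∈ₛ Y →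
    Star (Minus u v ↾ (_≢ c)) u v → Star (Minus u v ↾ (_≢ z)) u v
  linked-Y {X} {Y} {c} {d} s {u} {v} {z} z∈Y u∉Y v∉Y walk =
    subst₂ (Star (Minus u v ↾ (_≢ z))) (ρ-id u∉Y) (ρ-id v∉Y) (kleisliStar ρ contract walk)
    where
    open Split s
    ρ : Fin (n G) → Fin (n G)
    ρ w = if Y w then d else w

    ρ-id : ∀ {w} → ¬ w ∈ₛ Y → ρ w ≡ w
    ρ-id {w} w∉Y with Y w
    ... | true  = contradiction refl w∉Y
    ... | false = refl

    ρ-d : ∀ {w} → w ∈ₛ Y → ρ w ≡ d
    ρ-d w∈Y rewrite w∈Y = refl

    leaveY : ∀ {x y} → x ∈ₛ Y → ¬ y ∈ₛ Y → Adj G x y → y ≢ c → y ≡ d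
    leaveY {x} {y} x∈Y y∉Y e y≢c with nbrsX-closed (split-swapXY s) x∈Y e
    ... | inj₁ y∈Y        = contradiction y∈Y y∉Y
    ... | inj₂ (inj₁ y≡c) = contradiction y≡c y≢c
    ... | inj₂ (inj₂ y≡d) = y≡d

    stop : ∀ {x y} → x ≡ y → Star (Minus u v ↾ (_≢ z)) x y
    stop refl = ε

    contract : ∀ {x y} → (Minus u v ↾ (_≢ c)) x y → Star (Minus u v ↾ (_≢ z)) (ρ x) (ρ y)
    contract {x} {y} (h@(e , _) , x≢c , y≢c) = case ((x ∈? Y) , (y ∈? Y)) of λ where
      (yes x∈Y , yes y∈Y) → stop (trans (ρ-d x∈Y) (≡-sym (ρ-d y∈Y)))
      (yes x∈Y , no y∉Y)  → stop (trans (ρ-d x∈Y) (≡-sym (trans (ρ-id y∉Y) (leaveY x∈Y y∉Y e y≢c))))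
      (no x∉Y , yes y∈Y)  → stop (trans (ρ-id x∉Y) (trans (leaveY y∈Y x∉Y (Adj-sym {G} e) x≢c) (≡-sym (ρ-d y∈Y))))
      (no x∉Y , no y∉Y)   → subst₂ (Star (Minus u v ↾ (_≢ z))) (≡-sym (ρ-id x∉Y)) (≡-sym (ρ-id y∉Y))
        ((h , (λ { refl → x∉Y z∈Y }) , (λ { refl → y∉Y z∈Y })) ◅ ε)

  -- A walk in `G` minus `x` may use the edge `uv`; each such step is replaced by the walk that
  -- `linked` supplies. For `x = v` the walk cannot use that edge.
  linked-bypass : TwoConnected G → ∀ {u v} → Adj G u v →
    (∀ {z} → z ≢ u → z ≢ v → Star (Minus u v ↾ (_≢ z)) u v) →
    ∀ {x y} → x ≢ u → y ≢ x → Σ (SPath (Minus u v) y u) λ r → ¬ x ∈ᵖ r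
  linked-bypass tc {u} {v} uv linked {x} {y} x≢u y≢x =
    let p , p⊆ = loopErase {S = _≢ x} y≢x walk in p , λ x∈p → p⊆ x∈p refl
    where
    detour : x ≢ v → ∀ {s t} → (Adj G ↾ (_≢ x)) s t → Star (Minus u v ↾ (_≢ x)) s t
    detour x≢v {s} {t} (e , s≢x , t≢x) with (s ≟ u) ×-dec (t ≟ v) | (s ≟ v) ×-dec (t ≟ u)
    ... | yes (refl , refl) | _                 = linked x≢u x≢v
    ... | no _              | yes (refl , refl) =
      reverse (λ (h , p , q) → Minus-sym h , q , p) (linked x≢u x≢v)
    ... | no ¬uv            | no ¬vu            = ((e , ¬uv , ¬vu) , s≢x , t≢x) ◅ ε

    walk : Star (Minus u v ↾ (_≢ x)) y u
    walk with x ≟ v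
    ... | no x≢v = kleisliStar id (detour x≢v) (avoiding {G} tc x y≢x (x≢u ∘ ≡-sym))
    ... | yes refl = Star-map
      (λ (e , s≢v , t≢v) → (e , (λ (_ , t≡v) → t≢v t≡v) , (λ (s≡v , _) → s≢v s≡v)) , s≢v , t≢v)
      (avoiding {G} tc v y≢x (Adj⇒≢ {G} uv))

  -- Two disjoint u-v paths in G minus uv form a cycle with chord uv.
  twoPaths⇒⊥ : Chordless G → ∀ {u v} → Adj G u v → ¬ TwoPaths (Minus u v) v u
  twoPaths⇒⊥ chordless uv ([ _ ] , _ , _) = Adj⇒≢ {G} uv refl
  twoPaths⇒⊥ chordless uv (cons _ _ _ , [ _ ] , _) = Adj⇒≢ {G} uv refl
  twoPaths⇒⊥ chordless {u} {v} uv (cons (e₁ , _ , ¬vu₁) p v∉p , cons (e₂ , _ , ¬vu₂) q v∉q , meet) =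
    let p′ , p′⊆p = SPath-map proj₁ p
        q′ , q′⊆q = SPath-map proj₁ q
    in noTheta {G} chordless (Adj-sym {G} uv) e₁ e₂ (λ x₁≡u → ¬vu₁ (refl , x₁≡u)) (λ x₂≡u → ¬vu₂ (refl , x₂≡u))
      p′ q′ (v∉p ∘ p′⊆p) (v∉q ∘ q′⊆q)
      λ w∈p w∈q → [ (λ { refl → contradiction (p′⊆p w∈p) v∉p }) , id ]′ (meet (inj₂ (p′⊆p w∈p)) (inj₂ (q′⊆q w∈q)))

  linked⇒⊥ : TwoConnected G → Chordless G → ∀ {u v} → Adj G u v →
    ¬ (∀ {z} → z ≢ u → z ≢ v → Star (Minus u v ↾ (_≢ z)) u v)
  linked⇒⊥ tc chordless {u} {v} uv linked =
    let bypass = linked-bypass tc uv linked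
        -- Avoiding a third vertex `t` is a way to get from `bypass` some path from `v` to `u`,
        -- along which `twoPaths` can induct.
        t , t≢u , t≢v = third {G} tc u v
    in twoPaths⇒⊥ chordless uv
      (twoPaths bypass (proj₁ (bypass t≢u (t≢v ∘ ≡-sym))) (Adj⇒≢ {G} uv ∘ ≡-sym))

  -- Shows that `P` is a proper part of `X`. Either `v` itself is the witness, or one of its two
  -- neighbours in `X` is not `u`, and `u` is the only neighbour of `v` in `P`.
  outside : ∀ {u v z P Q X} → EdgeCut G u v z P Q → v ∈ₛ X ⊎ Two (λ x → x ∈ₛ X × Adj G v x) →
    ∃[ x ] x ∈ₛ X × ¬ x ∈ₛ P
  outside {v = v} K (inj₁ v∈X) = v , v∈X , λ v∈P → EdgeCut.disjoint K v∈P (EdgeCut.v∈Q K)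
  outside {u = u} K (inj₂ two) = let x , (x∈X , vx) , x≢u = Two-avoid two u in
    x , x∈X , λ x∈P → x≢u (proj₁ (EdgeCut.cross K x∈P (EdgeCut.v∈Q K) (Adj-sym {G} vx)))

  threeNbrs-end : ∀ {X Y a b} → Split G X Y a b → a ∈ₛ X ⊎ Two (λ x → x ∈ₛ X × Adj G a x) → Three (Adj G a)
  threeNbrs-end s (inj₁ a∈X) = contradiction a∈X (Split.a∉X s)
  threeNbrs-end s (inj₂ (x , x′ , ((x∈X , ax) , (x′∈X , ax′)) , x≢x′)) =
    let y , ay , y∈Y = nbrInX (split-swapXY s) in
    x , x′ , y , (ax , ax′ , ay) , x≢x′ , (λ { refl → Split.XY-disj s _ x∈X y∈Y }) , (λ { refl → Split.XY-disj s _ x′∈X y∈Y })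

  -- Splits with a smallest side

  Minimal : VSet (n G) → Set
  Minimal X = ∀ X' Y' a' b' → Split G X' Y' a' b' → count X ≤ count X'

  module _ (tc : TwoConnected G) (chordless : Chordless G) {X Y a b} (s : Split G X Y a b) (min : Minimal X) where

    minimal⇒nbrs≥2 : 2 ≤ nbrsIn G X a
    minimal⇒nbrs≥2 = decidable-stable (2 ℕₚ.≤? nbrsIn G X a) λ few →
      let a′ , aa′ , a′∈X = nbrInX s
      in <⇒≱ (count-strict (X ∖ a′) X (λ w w∈ → proj₁ (∖⁻ X {a′} {w} w∈)) a′∈X
                (λ a′∈ → proj₂ (∖⁻ X {a′} {a′} a′∈) refl))
             (min _ _ _ _ (slide tc chordless s a′∈X aa′ λ {x} x∈X ax →
               count<2⇒unique few x a′ (∧⁺ x∈X ax) (∧⁺ a′∈X aa′)))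

    minimal⇒no-small-cut : ∀ {u v z P Q} → EdgeCut G u v z P Q → Three (Adj G u) → Three (Adj G v) →
      (∀ w → w ∈ₛ P → w ∈ₛ X) → ∀ {x} → x ∈ₛ X → ¬ ¬ x ∈ₛ P
    minimal⇒no-small-cut {u} {v} {z} {P} {Q} K deg-u deg-v P⊆X x∈X x∉P
      with Adj? {G} u z | Adj? {G} v z
    ... | no ¬uz | _ = <⇒≱ P<X (≤-trans (min _ _ _ _ (edgeCut⇒split tc K ¬uz deg-u deg-v))
        (count-mono (P ∖ u) P λ w w∈ → proj₁ (∖⁻ P {u} {w} w∈)))
      where P<X = count-strict P X P⊆X x∈X x∉P
    -- Seen from `v`, the cutset `{v,z}` has the sides `Q ∖ v` and `P`; they are exchanged so that
    -- the small side `P` comes first.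
    ... | yes _ | no ¬vz = <⇒≱ (count-strict P X P⊆X x∈X x∉P)
        (min _ _ _ _ (split-swapXY (edgeCut⇒split tc (edgeCut-swap K) ¬vz deg-v deg-u)))
    ... | yes uz | yes vz = noTriangle tc K chordless deg-u uz vz

    noEdgeCut : ∀ {u v z P Q} → EdgeCut G u v z P Q → Three (Adj G u) → Three (Adj G v) →
      (∀ {w} → w ≡ u ⊎ w ≡ v → w ∈ₛ X ⊎ Two (λ x → x ∈ₛ X × Adj G w x)) →
      u ∈ₛ X ⊎ v ∈ₛ X → ¬ z ∈ₛ Y → z ≢ a → ⊥
    noEdgeCut {u} {v} {z} {P} {Q} K deg-u deg-v rich u∨v∈X z∉Y z≢a with EdgeCut.cover K a
    ... | inj₂ (inj₂ a≡z) = z≢a (≡-sym a≡z)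
    ... | inj₂ (inj₁ a∈Q) = let x , x∈X , x∉P = outside K (rich (inj₂ refl)) in
      minimal⇒no-small-cut K deg-u deg-v (edgeCut-oneSide s z∉Y z≢a tc K u∨v∈X a∈Q) x∈X x∉P
    ... | inj₁ a∈P = let x , x∈X , x∉Q = outside K′ (rich (inj₁ refl)) in
      minimal⇒no-small-cut K′ deg-v deg-u (edgeCut-oneSide s z∉Y z≢a tc K′ (swap u∨v∈X) a∈P) x∈X x∉Q
      where K′ = edgeCut-swap K

  module _ (tc : TwoConnected G) (chordless : Chordless G) {X Y a b} (s : Split G X Y a b) (min : Minimal X) where
    open Split s

    minimal⇒rich : ∀ {w} → InX∪ X a b w → w ∈ₛ X ⊎ Two (λ x → x ∈ₛ X × Adj G w x)
    minimal⇒rich (inj₁ w∈X)         = inj₁ w∈X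
    minimal⇒rich (inj₂ (inj₁ refl)) = inj₂ (Two-map ∧⁻ (count≥2⇒Two (minimal⇒nbrs≥2 tc chordless s min)))
    minimal⇒rich (inj₂ (inj₂ refl)) =
      inj₂ (Two-map ∧⁻ (count≥2⇒Two (minimal⇒nbrs≥2 tc chordless (split-swapAB s) min)))

    ∉Y : ∀ {w} → InX∪ X a b w → ¬ w ∈ₛ Y
    ∉Y {w} (inj₁ w∈X)         = XY-disj w w∈X
    ∉Y     (inj₂ (inj₁ refl)) = a∉Y
    ∉Y     (inj₂ (inj₂ refl)) = b∉Y

    edge-meets-X : ∀ {u v} → InX∪ X a b u → InX∪ X a b v → Adj G u v → u ∈ₛ X ⊎ v ∈ₛ X
    edge-meets-X (inj₁ u∈X) _ _ = inj₁ u∈X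
    edge-meets-X _ (inj₁ v∈X) _ = inj₂ v∈X
    edge-meets-X (inj₂ (inj₁ refl)) (inj₂ (inj₁ refl)) e = contradiction refl (Adj⇒≢ {G} e)
    edge-meets-X (inj₂ (inj₁ refl)) (inj₂ (inj₂ refl)) e = contradiction e nonadj
    edge-meets-X (inj₂ (inj₂ refl)) (inj₂ (inj₁ refl)) e = contradiction (Adj-sym {G} e) nonadj
    edge-meets-X (inj₂ (inj₂ refl)) (inj₂ (inj₂ refl)) e = contradiction refl (Adj⇒≢ {G} e)

    no-heavy-edge : ∀ {u v} → InX∪ X a b u → InX∪ X a b v → Adj G u v →
      Three (Adj G u) → ¬ Three (Adj G v)
    no-heavy-edge {u} {v} u∈ v∈ uv deg-u deg-v = linked⇒⊥ tc chordless uv linked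
      where
      meets-X = edge-meets-X u∈ v∈ uv

      rich : ∀ {w} → w ≡ u ⊎ w ≡ v → w ∈ₛ X ⊎ Two (λ x → x ∈ₛ X × Adj G w x)
      rich (inj₁ refl) = minimal⇒rich u∈
      rich (inj₂ refl) = minimal⇒rich v∈

      noCut : ∀ {z P Q} → ¬ z ∈ₛ Y → ¬ EdgeCut G u v z P Q
      noCut {z} z∉Y K with z ≟ a
      ... | no z≢a   = noEdgeCut tc chordless s min K deg-u deg-v rich meets-X z∉Y z≢a
      -- The vertex that locates `Y` relative to the cut must differ from `z`; when `z` is `a`, that
      -- vertex is `b`.
      ... | yes refl = noEdgeCut tc chordless (split-swapAB s) min K deg-u deg-v rich meets-X z∉Y a≢b

      linkedX : ∀ {z} → ¬ z ∈ₛ Y → z ≢ u → z ≢ v → Star (Minus u v ↾ (_≢ z)) u v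
      linkedX z∉Y z≢u z≢v = [ id , (λ (_ , _ , K) → ⊥-elim (noCut z∉Y K)) ]′ (linked-or-cut uv z≢u z≢v)

      linked : ∀ {z} → z ≢ u → z ≢ v → Star (Minus u v ↾ (_≢ z)) u v
      linked {z} z≢u z≢v with z ∈? Y
      ... | no z∉Y = linkedX z∉Y z≢u z≢v
      -- Being non-adjacent, `a` and `b` are not both ends of `uv`.
      ... | yes z∈Y with a ≟ u | a ≟ v
      ... | no a≢u   | no a≢v   = linked-Y s z∈Y (∉Y u∈) (∉Y v∈) (linkedX a∉Y a≢u a≢v)
      ... | yes refl | _        = linked-Y (split-swapAB s) z∈Y (∉Y u∈) (∉Y v∈)
        (linkedX b∉Y (a≢b ∘ ≡-sym) λ { refl → nonadj uv })
      ... | no _     | yes refl = linked-Y (split-swapAB s) z∈Y (∉Y u∈) (∉Y v∈)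
        (linkedX b∉Y (λ { refl → nonadj (Adj-sym {G} uv) }) (a≢b ∘ ≡-sym))

    -- At `a` and `b` the count in the block includes `w`, so the three neighbours come from
    -- elsewhere: two in `X` by minimality, one in `Y`. A vertex of `X` is not adjacent to `w`, so
    -- its neighbours in the block are neighbours in `G`.
    threeNbrs : ∀ {u} → InX∪ X a b u → 3 ≤ degIn (extGraph G a b) (blockSet G X a b) (suc u) → Three (Adj G u)
    threeNbrs {u} (inj₂ (inj₁ refl)) _ = threeNbrs-end s (minimal⇒rich (inj₂ (inj₁ refl)))
    threeNbrs {u} (inj₂ (inj₂ refl)) _ = threeNbrs-end (split-swapAB s) (minimal⇒rich (inj₂ (inj₂ refl)))
    threeNbrs {u} (inj₁ u∈X) deg = old (Three-map ∧⁻ (count≥3⇒Three deg))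
      where
      ¬w : ¬ wAdj a b u ≡ true
      -- By computation, `wAdj a b` is the empty set extended by `∪ab (a , b)`.
      ¬w t = [ (λ ()) , [ (λ { refl → a∉X u∈X }) , (λ { refl → b∉X u∈X }) ]′ ]′ (∪ab⁻ (λ _ → false) a b {u} t)

      old : Three (λ w → w ∈ₛ blockSet G X a b × extE G a b (suc u) w ≡ true) → Three (Adj G u)
      old (zero , _ , _ , ((_ , t) , _) , _) = contradiction t ¬w
      old (_ , zero , _ , (_ , (_ , t) , _) , _) = contradiction t ¬w
      old (_ , _ , zero , (_ , _ , (_ , t)) , _) = contradiction t ¬w
      old (suc x , suc y , suc z , ((_ , ex) , (_ , ey) , (_ , ez)) , x≢y , x≢z , y≢z) =
        x , y , z , (ex , ey , ez) , x≢y ∘ cong suc , x≢z ∘ cong suc , y≢z ∘ cong suc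

    w-degree : degIn (extGraph G a b) (blockSet G X a b) zero ≤ 2
    w-degree = ℕₚ.≮⇒≥ λ deg → few (Three-map ∧⁻ (count≥3⇒Three deg))
      where
      a∨b : ∀ {w} → wAdj a b w ≡ true → w ≡ a ⊎ w ≡ b
      a∨b {w} t = [ (λ ()) , id ]′ (∪ab⁻ (λ _ → false) a b {w} t)

      few : ¬ Three (λ w → w ∈ₛ blockSet G X a b × extE G a b zero w ≡ true)
      few (suc x , suc y , suc z , ((_ , ex) , (_ , ey) , (_ , ez)) , x≢y , x≢z , y≢z)
        with a∨b {x} ex | a∨b {y} ey | a∨b {z} ez
      ... | inj₁ refl | inj₁ refl | _         = x≢y refl
      ... | inj₂ refl | inj₂ refl | _         = x≢y refl
      ... | inj₁ refl | inj₂ refl | inj₁ refl = x≢z refl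
      ... | inj₁ refl | inj₂ refl | inj₂ refl = y≢z refl
      ... | inj₂ refl | inj₁ refl | inj₁ refl = y≢z refl
      ... | inj₂ refl | inj₁ refl | inj₂ refl = x≢z refl

    block-twoSparse : BlockTwoSparse G X a b
    block-twoSparse zero v _ _ _ = inj₁ w-degree
    block-twoSparse (suc u) zero _ _ _ = inj₂ w-degree
    block-twoSparse (suc u) (suc v) u∈ v∈ uv
      with degIn (extGraph G a b) (blockSet G X a b) (suc u) ℕₚ.≤? 2
         | degIn (extGraph G a b) (blockSet G X a b) (suc v) ℕₚ.≤? 2
    ... | yes du | _      = inj₁ du
    ... | no _   | yes dv = inj₂ dv
    ... | no du  | no dv  = ⊥-elim (no-heavy-edge u∈′ v∈′ uv (threeNbrs u∈′ (≰⇒> du)) (threeNbrs v∈′ (≰⇒> dv)))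
      where
      u∈′ = ∪ab⁻ X a b {u} u∈
      v∈′ = ∪ab⁻ X a b {v} v∈

theorem3 : (G : Graph) → TwoConnected G → Chordless G → ¬ TwoSparse G →
    ∀ X Y a b → Split G X Y a b →
    (∀ X' Y' a' b' → Split G X' Y' a' b' → count X ≤ count X') →
    (nbrsIn G X a ≥ 2) × (nbrsIn G X b ≥ 2) × BlockTwoSparse G X a b
theorem3 G tc chordless _ X Y a b s min =
  minimal⇒nbrs≥2 tc chordless s min ,
  minimal⇒nbrs≥2 tc chordless (split-swapAB s) min ,
  block-twoSparse tc chordless s min
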